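{- There is an absolute constant $C$ such that for all positive integers $n$ and all integers $k\ge 2$ there is a CNF encoding of $\mathsf{AtMostK}(x_1,\dots,x_n)$ using at most $2n + C\sqrt{nk^3\log_k^3 n}$ clauses and at most $C\sqrt{nk^3\log_k^3 n}$ auxiliary variables.
   Context: $\mathsf{AtMostK}(x_1,\dots,x_n)$ is true iff at most $k$ of $x_1,\dots,x_n$ are true; $\log_k$ is the base-$k$ logarithm. A CNF formula is a set of clauses; its size is its number of clauses. For a partial assignment $\tau$, $\varphi|_\tau$ deletes clauses satisfied by $\tau$ and literals falsified by $\tau$. A CNF $\varphi$ over $X\sqcup Y$, $X=(x_1,\dots,x_n)$, encodes $f$ if for every assignment $\tau$ of $X$, $f(\tau)=\top$ iff $\varphi|_\tau$ is satisfiable; variables in $Y$ are auxiliary. -}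

module Defs where

open import Data.Nat using (ℕ; zero; suc; _+_; _*_; _^_; _≤_; _<_)
open import Data.Bool using (Bool; true; false; not; if_then_else_)
open import Data.Fin using (Fin; zero; suc)
open import Data.List using (List)
open import Data.List.Relation.Unary.All using (All)
open import Data.List.Relation.Unary.Any using (Any)
open import Data.Vec.Functional using (_++_)
open import Data.Product using (∃-syntax; _×_)
open import Function.Bundles using (_⇔_)
open import Relation.Binary.PropositionalEquality using (_≡_)

data Literal (v : ℕ) : Set where
  pos : Fin v → Literal v
  neg : Fin v → Literal v

Clause : ℕ → Set
Clause v = List (Literal v)

CNF : ℕ → Set
CNF v = List (Clause v)

Assignment : ℕ → Set
Assignment v = Fin v → Bool

evalLit : ∀ {v} → Assignment v → Literal v → Bool
evalLit ρ (pos x) = ρ x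
evalLit ρ (neg x) = not (ρ x)

SatClause : ∀ {v} → Assignment v → Clause v → Set
SatClause ρ c = Any (λ l → evalLit ρ l ≡ true) c

SatCNF : ∀ {v} → Assignment v → CNF v → Set
SatCNF ρ φ = All (SatClause ρ) φ

countTrue : ∀ {n} → (Fin n → Bool) → ℕ
countTrue {zero} τ = 0
countTrue {suc n} τ = (if τ zero then 1 else 0) + countTrue (λ i → τ (suc i))

AtMostK : (k n : ℕ) → (Fin n → Bool) → Set
AtMostK k n τ = countTrue τ ≤ k

Encodes : (n a : ℕ) → ((Fin n → Bool) → Set) → CNF (n + a) → Set
Encodes n a f φ = (τ : Fin n → Bool) → f τ ⇔ (∃[ σ ] SatCNF (τ ++ σ) φ)

-- BoundedBy C n k m  ⇔  (m : ℝ) ≤ C * sqrt (n * k^3 * (log_k n)^3), for k ≥ 2, n ≥ 1.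
-- Exact rational characterisation: m ≤ C√(n k³ L³) (L = log_k n ≥ 0) iff
-- every nonnegative rational r = p/s with r³ < m²/(C² n k³) satisfies r ≤ L,
-- and r ≤ log_k n iff k^p ≤ n^s.
BoundedBy : (C n k m : ℕ) → Set
BoundedBy C n k m =
  (p s : ℕ) → 1 ≤ s → p ^ 3 * (C * C) * n * k ^ 3 < m * m * s ^ 3 → k ^ p ≤ n ^ s

{-# OPTIONS --safe #-}
-- Place the n items in a grid with c q rows and c columns, where c² q is about n. Each row
-- r is a word of length l + 2 over 𝔽_q (k^l ≤ n < k^(l+1)), encoded by its Reed–Solomon
-- values code r a at d = k (l + 2) points a. Two rows agree in at most l + 1 points, so
-- among at most k rows each row r has a point a whose slot (a , code r a) it does not
-- share. A true item forces its row to be used and, by one wide clause, some cell formed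
-- by a slot of its row and its own column. A used slot may be owned by one used row only,
-- so true items inject into used cells, and it is enough to count used cells, which adders
-- do with linearly many clauses. Beyond the 2 n clauses this costs O(d q c), which is
-- O(√(n k³ l³)) for a prime q = O(d). Such a prime exists by Chebyshev's method:
-- lcm(1..2m) ≥ 2^m, whereas lcm(1..2m) divides C(2m,m) lcm(1..m), so that lcm(1..2^j) ≤
-- 2^(2·2^j); hence lcm(1..m) cannot stay nearly constant as m grows by a factor 16.
module Submission where

open import Defs
open import Data.Bool using (Bool; true; false; not; if_then_else_)
import Data.Bool.Properties as Bool
open import Data.Nat
open import Data.Nat.Combinatorics using (nCk≡n!/k![n-k]!; k![n∸k]!∣n!; nCk+nC[k+1]≡[n+1]C[k+1]; nC1≡n)
  renaming (_C_ to _choose_)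
open import Data.Nat.Divisibility hiding (quotient)
open import Data.Nat.DivMod using (m/n*n≡m)
open import Data.Nat.LCM using (lcm; m∣lcm[m,n]; n∣lcm[m,n]; lcm-least)
open import Data.Nat.ListAction using (product)
open import Data.Nat.ListAction.Properties using (∈⇒∣product)
open import Data.Nat.Primality using (Prime; prime?; prime⇒nonZero; prime⇒nonTrivial; euclidsLemma)
open import Data.Nat.Primality.Factorisation using (factorise)
open import Data.Nat.Properties
open import Data.Nat.Tactic.RingSolver using (solve-∀)
open import Data.Integer as ℤ using (ℤ; 0ℤ) renaming (+_ to int)
open import Data.Integer.DivMod using (_%ℕ_; _/ℕ_; n%ℕd<d; a≡a%ℕn+[a/ℕn]*n)
import Data.Integer.Divisibility.Signed as ℤ
import Data.Integer.Properties as ℤ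
open import Data.Integer.Tactic.RingSolver using () renaming (solve-∀ to solve-∀ℤ)
open import Data.Fin as Fin using (Fin; toℕ; fromℕ<; inject≤; inject₁; finToFun; funToFin; splitAt; _↑ˡ_; _↑ʳ_)
open import Data.Fin.Induction using (<-weakInduction)
import Data.Fin.Properties as Fin
open import Data.List as List using (List; []; _∷_; length; filter; allFin)
open import Data.List.Membership.Propositional using (_∈_; find)
open import Data.List.Membership.Propositional.Properties using (∈-filter⁻)
open import Data.List.Properties using (length-tabulate; length-++; length-map)
open import Data.List.Relation.Unary.All as All using (All; []; _∷_)
import Data.List.Relation.Unary.All.Properties as All
open import Data.List.Relation.Unary.AllPairs as AllPairs using (AllPairs; []; _∷_)
import Data.List.Relation.Unary.AllPairs.Properties as AllPairs
open import Data.List.Relation.Unary.Any as Any using (Any; here; there)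
import Data.List.Relation.Unary.Any.Properties as Any
open import Data.List.Relation.Unary.Unique.Propositional using (Unique)
import Data.List.Relation.Unary.Unique.Propositional.Properties as Unique
open import Data.Product using (∃-syntax; _×_; _,_; proj₁; proj₂; map₁; uncurry)
open import Data.Product.Function.NonDependent.Propositional using (_×-↔_)
open import Data.Product.Properties using (≡-dec; ,-injectiveˡ; ,-injectiveʳ)
open import Data.Sum as Sum using (inj₁; inj₂; _⊎_; [_,_])
open import Data.Sum.Function.Propositional using (_⊎-↔_)
open import Data.Vec as Vec using (Vec; []; _∷_)
open import Data.Vec.Functional as Functional using (updateAt)
open import Data.Vec.Functional.Properties using (updateAt-minimal)
open import Data.Vec.Properties using (lookup∘tabulate; ∷-injective)
open import Data.Vec.Relation.Unary.All as VecAll using ([]; _∷_)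
open import Function using (_∘_; id; const; _↔_; Inverse; mk⇔)
open import Function.Construct.Composition using (_↔-∘_)
open import Function.Construct.Identity using (↔-id)
open import Relation.Binary.PropositionalEquality hiding ([_])
open import Relation.Nullary
open import Relation.Nullary.Decidable using (True; toWitness; fromWitness; dec-true; dec-false)

-- All costs are governed by `T = d * q * c`, the number of cells and also of pairs of a row and a
-- point. Since T² = d² q · c² q, with d and q of order k l and c² q of order n, T² is of order n k³
-- l³. The obstacle is to enforce one owner per slot with O(T) clauses: a slot is shared by c rows,
-- so excluding them in pairs would cost about T c clauses. Therefore a row is a pair (j , b) whose
-- constant coefficient b already separates rows with equal j at every point. Only j remains to be
-- singled out at each slot, which a monotone chain of c + 1 variables does at the price of two
-- clauses for each row and point. The modulus q is prime so that roots can be counted, at least d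
-- so that the evaluation points stay distinct, and O(d) to keep T small. The leading term 2 n is
-- exact because an item has just two clauses of its own; the wide one leaves the choice of the
-- point to the assignment.

-- Binomial identities and elementary bounds.

-- Binomial coefficients written as C(a+b, a), so that no subtraction occurs.
binom : ℕ → ℕ → ℕ
binom a b = (a + b) choose a

binom-! : ∀ a b → binom a b * (a ! * b !) ≡ (a + b) !
binom-! a b = begin
  binom a b * (a ! * b !)
    ≡⟨ cong (λ c → binom a b * (a ! * c !)) (sym (m+n∸m≡n a b)) ⟩
  binom a b * (a ! * (a + b ∸ a) !)
    ≡⟨ cong (_* (a ! * (a + b ∸ a) !)) (nCk≡n!/k![n-k]! (m≤m+n a b)) ⟩
  ((a + b) ! / (a ! * (a + b ∸ a) !)) * (a ! * (a + b ∸ a) !)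
    ≡⟨ m/n*n≡m (k![n∸k]!∣n! (m≤m+n a b)) ⟩
  (a + b) ! ∎
  where
  open ≡-Reasoning
  instance
    _ = a !* (a + b ∸ a) !≢0

binom≢0 : ∀ a b → NonZero (binom a b)
binom≢0 a b = m*n≢0⇒m≢0 (binom a b) {{subst NonZero (sym (binom-! a b)) ((a + b) !≢0)}}

binom-absorbˡ : ∀ a b → suc a * binom (suc a) b ≡ suc (a + b) * binom a b
binom-absorbˡ a b = *-cancelʳ-≡ _ _ (a ! * b !) (begin
  suc a * binom (suc a) b * (a ! * b !)      ≡⟨ rearrange (suc a) (binom (suc a) b) (a !) (b !) ⟩
  binom (suc a) b * ((suc a) ! * b !)        ≡⟨ binom-! (suc a) b ⟩
  suc (a + b) * (a + b) !                    ≡⟨ cong (suc (a + b) *_) (binom-! a b) ⟨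
  suc (a + b) * (binom a b * (a ! * b !))    ≡⟨ *-assoc (suc (a + b)) (binom a b) _ ⟨
  suc (a + b) * binom a b * (a ! * b !)      ∎)
  where
  open ≡-Reasoning
  rearrange : ∀ x y f g → x * y * (f * g) ≡ y * ((x * f) * g)
  rearrange = solve-∀
  instance
    _ = a !* b !≢0

binom-comm : ∀ a b → binom a b ≡ binom b a
binom-comm a b = *-cancelʳ-≡ _ _ (a ! * b !) (begin
  binom a b * (a ! * b !)  ≡⟨ binom-! a b ⟩
  (a + b) !                ≡⟨ cong _! (+-comm a b) ⟩
  (b + a) !                ≡⟨ binom-! b a ⟨
  binom b a * (b ! * a !)  ≡⟨ cong (binom b a *_) (*-comm (b !) (a !)) ⟩
  binom b a * (a ! * b !)  ∎)
  where
  open ≡-Reasoning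
  instance
    _ = a !* b !≢0

binom-absorbʳ : ∀ a b → suc b * binom a (suc b) ≡ suc (a + b) * binom a b
binom-absorbʳ a b = begin
  suc b * binom a (suc b)      ≡⟨ cong (suc b *_) (binom-comm a (suc b)) ⟩
  suc b * binom (suc b) a      ≡⟨ binom-absorbˡ b a ⟩
  suc (b + a) * binom b a      ≡⟨ cong₂ (λ s c → suc s * c) (+-comm b a) (binom-comm b a) ⟩
  suc (a + b) * binom a b      ∎
  where open ≡-Reasoning

-- Both products are the multinomial coefficient (a + b + c)! / (a! b! c!).
binom-trinomial : ∀ a b c → binom (a + b) c * binom a b ≡ binom a (b + c) * binom b c
binom-trinomial a b c = *-cancelʳ-≡ _ _ (a ! * b ! * c !) (begin
  binom (a + b) c * binom a b * (a ! * b ! * c !)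
    ≡⟨ left (binom (a + b) c) (binom a b) (a !) (b !) (c !) ⟩
  binom (a + b) c * ((binom a b * (a ! * b !)) * c !)
    ≡⟨ cong (λ z → binom (a + b) c * (z * c !)) (binom-! a b) ⟩
  binom (a + b) c * ((a + b) ! * c !)
    ≡⟨ binom-! (a + b) c ⟩
  (a + b + c) !
    ≡⟨ cong _! (+-assoc a b c) ⟩
  (a + (b + c)) !
    ≡⟨ binom-! a (b + c) ⟨
  binom a (b + c) * (a ! * (b + c) !)
    ≡⟨ cong (λ z → binom a (b + c) * (a ! * z)) (binom-! b c) ⟨
  binom a (b + c) * (a ! * (binom b c * (b ! * c !)))
    ≡⟨ right (binom a (b + c)) (binom b c) (a !) (b !) (c !) ⟩
  binom a (b + c) * binom b c * (a ! * b ! * c !) ∎)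
  where
  open ≡-Reasoning
  left : ∀ x y f g h → x * y * (f * g * h) ≡ x * ((y * (f * g)) * h)
  left = solve-∀
  right : ∀ x y f g h → x * (f * (y * (g * h))) ≡ x * y * (f * g * h)
  right = solve-∀
  instance
    _ = a !* b !≢0
    _ = c !≢0
    _ = m*n≢0 (a ! * b !) (c !)

nCk≤2^n : ∀ n k → n choose k ≤ 2 ^ n
nCk≤2^n zero    zero    = ≤-refl
nCk≤2^n zero    (suc k) = z≤n
nCk≤2^n (suc n) zero    = m^n>0 2 (suc n)
nCk≤2^n (suc n) (suc k) = begin
  suc n choose suc k      ≡⟨ nCk+nC[k+1]≡[n+1]C[k+1] n k ⟨
  n choose k + n choose suc k  ≤⟨ +-mono-≤ (nCk≤2^n n k) (nCk≤2^n n (suc k)) ⟩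
  2 ^ n + 2 ^ n      ≡⟨ cong (2 ^ n +_) (+-identityʳ (2 ^ n)) ⟨
  2 ^ suc n          ∎
  where open ≤-Reasoning

-- By Pascal's rule C(2m+2, m+1) is the sum of the two equal middle entries of the row above, and
-- each of these is at least C(2m, m).
2^m≤binom : ∀ m → 2 ^ m ≤ binom m m
2^m≤binom zero    = ≤-refl
2^m≤binom (suc m) = begin
  2 * 2 ^ m                          ≤⟨ *-monoʳ-≤ 2 (2^m≤binom m) ⟩
  2 * binom m m                      ≤⟨ *-monoʳ-≤ 2 grow ⟩
  2 * binom (suc m) m                ≡⟨ cong (binom (suc m) m +_) (+-identityʳ _) ⟩
  binom (suc m) m + binom (suc m) m  ≡⟨ cong (_+ binom (suc m) m) (trans (binom-comm (suc m) m) (cong (_choose m) (+-suc m m))) ⟩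
  suc (m + m) choose m + suc (m + m) choose suc m
                                     ≡⟨ nCk+nC[k+1]≡[n+1]C[k+1] (suc (m + m)) m ⟩
  suc (suc (m + m)) choose suc m          ≡⟨ cong (λ z → suc z choose suc m) (+-suc m m) ⟨
  binom (suc m) (suc m)              ∎
  where
  open ≤-Reasoning
  grow : binom m m ≤ binom (suc m) m
  grow = ≤-trans (m≤m+n _ _) (≤-reflexive (nCk+nC[k+1]≡[n+1]C[k+1] (m + m) m))

-- Size of lcm(1..m), from above and from below.

lcmUpTo : ℕ → ℕ
lcmUpTo zero    = 1
lcmUpTo (suc m) = lcm (suc m) (lcmUpTo m)

∣lcmUpTo : ∀ {m i} → 1 ≤ i → i ≤ m → i ∣ lcmUpTo m
∣lcmUpTo {zero}  1≤i i≤m = contradiction (≤-trans 1≤i i≤m) λ ()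
∣lcmUpTo {suc m} 1≤i i≤m with m≤n⇒m<n∨m≡n i≤m
... | inj₁ (s≤s i≤m′) = ∣-trans (∣lcmUpTo 1≤i i≤m′) (n∣lcm[m,n] (suc m) (lcmUpTo m))
... | inj₂ refl       = m∣lcm[m,n] (suc m) (lcmUpTo m)

lcmUpTo-least : ∀ m {D} → (∀ i → 1 ≤ i → i ≤ m → i ∣ D) → lcmUpTo m ∣ D
lcmUpTo-least zero    h = 1∣ _
lcmUpTo-least (suc m) h = lcm-least (h (suc m) (s≤s z≤n) ≤-refl)
  (lcmUpTo-least m (λ i 1≤i i≤m → h i 1≤i (m≤n⇒m≤1+n i≤m)))

-- The lcm divides `m !`, which is nonzero. Positivity is what later turns divisibilities into
-- inequalities.
lcmUpTo≥1 : ∀ m → 1 ≤ lcmUpTo m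
lcmUpTo≥1 m = n≢0⇒n>0 (λ eq → m!≢0 (0∣⇒≡0 (subst (_∣ m !) eq (lcmUpTo-least m (λ i 1≤i i≤m → lemma 1≤i i≤m)))))
  where
  m!≢0 : m ! ≢ 0
  m!≢0 = ≢-nonZero⁻¹ (m !) {{m !≢0}}
  lemma : ∀ {i m} → 1 ≤ i → i ≤ m → i ∣ m !
  lemma {i} {zero} 1≤i i≤m = contradiction (≤-trans 1≤i i≤m) λ ()
  lemma {i} {suc m} 1≤i i≤m with m≤n⇒m<n∨m≡n i≤m
  ... | inj₁ (s≤s i≤m′) = ∣n⇒∣m*n (suc m) (lemma 1≤i i≤m′)
  ... | inj₂ refl       = m∣m*n (m !)

-- The reciprocals 1 / (t C(m,t)) form Leibniz's harmonic triangle: each entry is the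
-- difference of its neighbour and the entry above.
leibniz : ∀ t u {D} → (∀ i → 1 ≤ i → i ≤ suc t + u → i ∣ D) → suc t * binom (suc t) u ∣ D
leibniz zero    u {D} h = subst (_∣ D) (sym eq) (h (suc u) (s≤s z≤n) ≤-refl)
  where
  eq : 1 * binom 1 u ≡ suc u
  eq = trans (*-identityˡ _) (trans (binom-comm 1 u) (trans (binom-comm u 1) (nC1≡n (suc u))))
leibniz (suc t) u {D} h
  with leibniz t u {D} (λ i p q → h i p (m≤n⇒m≤1+n q))
     | leibniz t (suc u) {D} (λ i p q → h i p (≤-trans q (≤-reflexive (cong suc (+-suc t u)))))
... | divides x D≡xA | divides y D≡yB = ∣m+n∣m⇒∣n {m = E * y} {n = D} (subst (E ∣_) eq (m∣m*n x)) (m∣m*n y)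
  where
  open ≡-Reasoning
  β γ A B E : ℕ
  β = binom (suc t) u
  γ = binom (suc t) (suc u)
  A = suc t * β
  B = suc t * γ
  E = suc (suc t) * binom (suc (suc t)) u
  E≡ : E ≡ suc (suc t + u) * β
  E≡ = binom-absorbˡ (suc t) u
  γ≡ : suc u * γ ≡ E
  γ≡ = trans (binom-absorbʳ (suc t) u) (sym E≡)
  -- This is 1/A = 1/B + 1/E with denominators cleared. With D = x A = y B it gives D/E = x - y,
  -- stated below without subtraction as E x = E y + D.
  AB+EA≡EB : A * B + E * A ≡ E * B
  AB+EA≡EB = begin
    A * B + E * A                                ≡⟨ cong (λ z → A * B + z * A) γ≡ ⟨
    A * B + suc u * γ * A                        ≡⟨ reassoc t u β γ ⟩
    suc (suc t + u) * β * B                      ≡⟨ cong (_* B) E≡ ⟨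
    E * B                                        ∎
    where
    reassoc : ∀ t u β γ → (suc t * β) * (suc t * γ) + suc u * γ * (suc t * β) ≡ suc (suc t + u) * β * (suc t * γ)
    reassoc = solve-∀
  instance
    _ = binom≢0 (suc t) u
    _ = binom≢0 (suc t) (suc u)
    _ = m*n≢0 (suc t) β
    _ = m*n≢0 (suc t) γ
    _ = m*n≢0 A B
  eq : E * x ≡ E * y + D
  eq = *-cancelʳ-≡ _ _ (A * B) (begin
    E * x * (A * B)            ≡⟨ s₁ E x A B ⟩
    E * B * (x * A)            ≡⟨ cong₂ _*_ (sym AB+EA≡EB) (sym D≡xA) ⟩
    (A * B + E * A) * D        ≡⟨ s₂ A B E D ⟩
    E * A * D + D * (A * B)    ≡⟨ cong (λ z → E * A * z + D * (A * B)) D≡yB ⟩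
    E * A * (y * B) + D * (A * B)  ≡⟨ s₃ E A y B D ⟩
    (E * y + D) * (A * B)      ∎)
    where
    s₁ : ∀ E x A B → E * x * (A * B) ≡ E * B * (x * A)
    s₁ = solve-∀
    s₂ : ∀ A B E D → (A * B + E * A) * D ≡ E * A * D + D * (A * B)
    s₂ = solve-∀
    s₃ : ∀ E A y B D → E * A * (y * B) + D * (A * B) ≡ (E * y + D) * (A * B)
    s₃ = solve-∀

lcmUpTo-double : ∀ m → lcmUpTo (m + m) ∣ binom m m * lcmUpTo m
lcmUpTo-double m = lcmUpTo-least (m + m) divides-each
  where
  -- i = m + t divides C(2m,m) · t C(m,t) = C(2m,i) · t C(i,t) = C(2m,i) · i C(i-1,t-1).
  large : ∀ m t u → m ≡ suc t + u → suc (m + t) ∣ binom m m * lcmUpTo m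
  large m t u refl = ∣-trans
    (divides (binom (m + suc t) u * binom m t) (begin
      binom m m * (suc t * binom (suc t) u)              ≡⟨ s₁ (binom m m) (suc t) (binom (suc t) u) ⟩
      suc t * (binom m m * binom (suc t) u)              ≡⟨ cong (suc t *_) (binom-trinomial m (suc t) u) ⟨
      suc t * (binom (m + suc t) u * binom m (suc t))    ≡⟨ s₁ (suc t) (binom (m + suc t) u) (binom m (suc t)) ⟩
      binom (m + suc t) u * (suc t * binom m (suc t))    ≡⟨ cong (binom (m + suc t) u *_) (binom-absorbʳ m t) ⟩
      binom (m + suc t) u * (suc (m + t) * binom m t)    ≡⟨ s₂ (binom (m + suc t) u) (suc (m + t)) (binom m t) ⟩
      binom (m + suc t) u * binom m t * suc (m + t)      ∎))
    (*-monoʳ-∣ (binom m m) (leibniz t u (λ i → ∣lcmUpTo)))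
    where
    open ≡-Reasoning
    s₁ : ∀ x y z → x * (y * z) ≡ y * (x * z)
    s₁ = solve-∀
    s₂ : ∀ x y z → x * (y * z) ≡ x * z * y
    s₂ = solve-∀
  divides-each : ∀ i → 1 ≤ i → i ≤ m + m → i ∣ binom m m * lcmUpTo m
  divides-each i 1≤i i≤2m with i ≤? m
  ... | yes i≤m = ∣n⇒∣m*n (binom m m) (∣lcmUpTo 1≤i i≤m)
  ... | no  i≰m with m≤n⇒∃[o]m+o≡n (≰⇒> i≰m)
  ...   | t , refl with m≤n⇒∃[o]m+o≡n (+-cancelˡ-≤ m (suc t) m (≤-trans (≤-reflexive (+-suc m t)) i≤2m))
  ...     | u , m≡ = large m t u (sym m≡)

-- The exponent 2 m reproduces itself: passing from m to 2 m costs a factor C(2m, m) ≤ 2^(2m), and 2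
-- m + 2 m = 2 (2 m). Powers of two are what repeated doubling from 1 reaches.
lcmUpTo-upper : ∀ j → lcmUpTo (2 ^ j) ≤ 2 ^ (2 * 2 ^ j)
lcmUpTo-upper zero    = s≤s z≤n
lcmUpTo-upper (suc j) = begin
  lcmUpTo (2 * m)          ≡⟨ cong (λ z → lcmUpTo (m + z)) (+-identityʳ m) ⟩
  lcmUpTo (m + m)          ≤⟨ ∣⇒≤ {{m*n≢0 _ _ {{binom≢0 m m}} {{>-nonZero (lcmUpTo≥1 m)}}}} (lcmUpTo-double m) ⟩
  binom m m * lcmUpTo m    ≤⟨ *-mono-≤ (nCk≤2^n (m + m) m) (lcmUpTo-upper j) ⟩
  2 ^ (m + m) * 2 ^ (2 * m)  ≡⟨ ^-distribˡ-+-* 2 (m + m) (2 * m) ⟨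
  2 ^ (m + m + 2 * m)      ≡⟨ cong (2 ^_) (s₁ m) ⟩
  2 ^ (2 * (2 * m))        ∎
  where
  open ≤-Reasoning
  m : ℕ
  m = 2 ^ j
  s₁ : ∀ m → m + m + 2 * m ≡ 2 * (2 * m)
  s₁ = solve-∀

-- The entry m C(2m, m) of Leibniz's triangle divides the lcm, and the binomial coefficient alone is
-- already large enough.
lcmUpTo-lower : ∀ m → 2 ^ m ≤ lcmUpTo (m + m)
lcmUpTo-lower zero      = ≤-refl
lcmUpTo-lower m@(suc t) = begin
  2 ^ m               ≤⟨ 2^m≤binom m ⟩
  binom m m           ≤⟨ m≤n*m (binom m m) m ⟩
  m * binom m m       ≤⟨ ∣⇒≤ {{>-nonZero (lcmUpTo≥1 (m + m))}} (leibniz t m (λ i → ∣lcmUpTo)) ⟩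
  lcmUpTo (m + m)     ∎
  where open ≤-Reasoning

-- A prime within a constant factor of any given number.

∣-exponent-^ : ∀ n {a b} → a ≤ b → n ^ a ∣ n ^ b
∣-exponent-^ n {b = b} z≤n       = 1∣ (n ^ b)
∣-exponent-^ n         (s≤s a≤b) = *-monoʳ-∣ n (∣-exponent-^ n a≤b)

product∣^ : ∀ {N} ps → All (_∣ N) ps → product ps ∣ N ^ length ps
product∣^ []       []         = ∣-refl
product∣^ (p ∷ ps) (p∣N ∷ hs) = *-pres-∣ p∣N (product∣^ ps hs)

2^length≤product : ∀ {ps} → All Prime ps → 2 ^ length ps ≤ product ps
2^length≤product []         = ≤-refl
2^length≤product (pr ∷ prs) = *-mono-≤ (nonTrivial⇒n>1 _ {{prime⇒nonTrivial pr}}) (2^length≤product prs)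

-- Without primes in (x , X], lcm(1..X) has no new prime factors beyond x, and a prime
-- factor above √X occurs only once in each number up to X.
lcmUpTo-gap : ∀ {x s X} e → X ≤ s * s → X ≤ 2 ^ suc e →
              (∀ p → Prime p → p ≤ X → p ≤ x) →
              lcmUpTo X ∣ lcmUpTo x * lcmUpTo s ^ suc e
lcmUpTo-gap {x} {s} {X} e X≤s² X≤2^e gap = lcmUpTo-least X divides-each
  where
  divides-each : ∀ t → 1 ≤ t → t ≤ X → t ∣ lcmUpTo x * lcmUpTo s ^ suc e
  divides-each t 1≤t t≤X with factorise t {{>-nonZero 1≤t}}
  ... | record { factors = ps ; isFactorisation = refl ; factorsPrime = prs } with Any.any? (s <?_) ps
  ...   | yes large with find large
  ...     | p , p∈ps , s<p with ∈⇒∣product p∈ps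
  -- The cofactor u is at most s, since otherwise t = u p > s² ≥ X. So p is absorbed by `lcmUpTo x`
  -- and u by a single factor `lcmUpTo s`; writing the exponent as `suc e` guarantees that there is
  -- one.
  ...       | divides u t≡up = subst (_∣ lcmUpTo x * lcmUpTo s ^ suc e) (trans (*-comm p u) (sym t≡up))
    (*-pres-∣ (∣lcmUpTo (≤-trans (s≤s z≤n) s<p) (gap p (All.lookup prs p∈ps) p≤X))
              (∣-trans (∣lcmUpTo (n≢0⇒n>0 u≢0) u≤s) (m∣m*n _)))
    where
    u≢0 : u ≢ 0
    u≢0 refl = contradiction (subst (1 ≤_) t≡up 1≤t) λ ()
    p≤X : p ≤ X
    p≤X = ≤-trans (m≤n*m p u {{≢-nonZero u≢0}}) (≤-trans (≤-reflexive (sym t≡up)) t≤X)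
    u≤s : u ≤ s
    u≤s = ≮⇒≥ λ s<u → <⇒≱ (*-mono-< s<u s<p) (≤-trans (≤-reflexive (sym t≡up)) (≤-trans t≤X X≤s²))
  -- All prime factors are at most s, and there are at most `suc e` of them because each is at least
  -- 2 while t ≤ 2^(e+1); each takes one factor `lcmUpTo s`.
  divides-each t 1≤t t≤X | record { factors = ps ; isFactorisation = refl ; factorsPrime = prs } | no ¬large =
    ∣n⇒∣m*n (lcmUpTo x) (∣-trans (product∣^ ps (small prs (All.¬Any⇒All¬ ps ¬large))) (∣-exponent-^ (lcmUpTo s) len≤))
    where
    small : ∀ {ps} → All Prime ps → All (λ p → ¬ s < p) ps → All (_∣ lcmUpTo s) ps
    small []         []         = []
    small (pr ∷ prs) (p≤s ∷ hs) = ∣lcmUpTo (>-nonZero⁻¹ _ {{prime⇒nonZero pr}}) (≮⇒≥ p≤s) ∷ small prs hs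
    len≤ : length ps ≤ suc e
    len≤ = ≮⇒≥ λ e<len → <⇒≱ (^-monoʳ-< 2 (s≤s (s≤s z≤n)) e<len)
      (≤-trans (2^length≤product prs) (≤-trans t≤X X≤2^e))

-- Here X = 256 y² = 16 x. Without a prime in the gap, lcm(1..X) is at least 2^(8x) = 2^(128 y²) but
-- at most 2^(2x + 2s(e+1)), whose exponent is at most 32 y² + 64 y² = 96 y². The search for the
-- prime is bounded and decidable, so refuting its failure yields the prime.
prime-in-gap : ∀ {x s y X} e → lcmUpTo x ≤ 2 ^ (2 * x) → lcmUpTo s ≤ 2 ^ (2 * s) →
               1 ≤ y → x ≡ 16 * (y * y) → s ≡ 16 * y → X ≡ s * s → X ≡ 2 ^ suc e → suc e ≤ 2 * y →
               ∃[ p ] Prime p × x < p × p ≤ X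
prime-in-gap {x} {s} {y} {X} e x-upper s-upper 1≤y x≡ s≡ X≡s² X≡2^ e≤
  with anyUpTo? (λ p → prime? p ×-dec x <? p) (suc X)
... | yes (p , s≤s p≤X , pr , x<p) = p , pr , x<p , p≤X
... | no none = contradiction too-large (<⇒≱ too-small)
  where
  open ≤-Reasoning
  gap : ∀ p → Prime p → p ≤ X → p ≤ x
  gap p pr p≤X = ≮⇒≥ λ x<p → none (p , s≤s p≤X , pr , x<p)
  halves : 8 * x + 8 * x ≡ X
  halves = trans (cong (λ z → 8 * z + 8 * z) x≡) (trans (expand y) (sym (trans X≡s² (cong (λ z → z * z) s≡))))
    where
    expand : ∀ y → 8 * (16 * (y * y)) + 8 * (16 * (y * y)) ≡ 16 * y * (16 * y)
    expand = solve-∀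
  too-large : 2 ^ (8 * x) ≤ 2 ^ (2 * x) * (2 ^ (2 * s)) ^ suc e
  too-large = begin
    2 ^ (8 * x)                          ≤⟨ lcmUpTo-lower (8 * x) ⟩
    lcmUpTo (8 * x + 8 * x)              ≡⟨ cong lcmUpTo halves ⟩
    lcmUpTo X                            ≤⟨ ∣⇒≤ {{m*n≢0 _ _ {{>-nonZero (lcmUpTo≥1 x)}} {{m^n≢0 (lcmUpTo s) (suc e) {{>-nonZero (lcmUpTo≥1 s)}}}}}}
                                              (lcmUpTo-gap {x} {s} e (≤-reflexive X≡s²) (≤-reflexive X≡2^) gap) ⟩
    lcmUpTo x * lcmUpTo s ^ suc e        ≤⟨ *-mono-≤ x-upper (^-monoˡ-≤ (suc e) s-upper) ⟩
    2 ^ (2 * x) * (2 ^ (2 * s)) ^ suc e  ∎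
  exponent : 2 * x + 2 * s * suc e < 8 * x
  exponent = begin-strict
    2 * x + 2 * s * suc e                         ≤⟨ +-monoʳ-≤ (2 * x) (*-monoʳ-≤ (2 * s) e≤) ⟩
    2 * x + 2 * s * (2 * y)                       ≡⟨ cong₂ (λ a b → 2 * a + 2 * b * (2 * y)) x≡ s≡ ⟩
    2 * (16 * (y * y)) + 2 * (16 * y) * (2 * y)   ≡⟨ collect y ⟩
    96 * (y * y)                                  <⟨ *-monoˡ-< (y * y) {{m*n≢0 y y {{y≢0}} {{y≢0}}}} (m≤m+n 97 31) ⟩
    128 * (y * y)                                 ≡⟨ *-assoc 8 16 (y * y) ⟩
    8 * (16 * (y * y))                            ≡⟨ cong (8 *_) x≡ ⟨
    8 * x                                         ∎
    where
    y≢0 : NonZero y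
    y≢0 = >-nonZero 1≤y
    collect : ∀ y → 2 * (16 * (y * y)) + 2 * (16 * y) * (2 * y) ≡ 96 * (y * y)
    collect = solve-∀
  too-small : 2 ^ (2 * x) * (2 ^ (2 * s)) ^ suc e < 2 ^ (8 * x)
  too-small = begin-strict
    2 ^ (2 * x) * (2 ^ (2 * s)) ^ suc e    ≡⟨ cong (2 ^ (2 * x) *_) (^-*-assoc 2 (2 * s) (suc e)) ⟩
    2 ^ (2 * x) * 2 ^ (2 * s * suc e)      ≡⟨ ^-distribˡ-+-* 2 (2 * x) (2 * s * suc e) ⟨
    2 ^ (2 * x + 2 * s * suc e)            <⟨ ^-monoʳ-< 2 (s≤s (s≤s z≤n)) exponent ⟩
    2 ^ (8 * x)                            ∎

7+i≤2^[3+i] : ∀ i → 7 + i ≤ 2 ^ (3 + i)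
7+i≤2^[3+i] zero    = m≤m+n 7 1
7+i≤2^[3+i] (suc i) = begin
  8 + i                      ≤⟨ +-mono-≤ (m^n>0 2 (3 + i)) (7+i≤2^[3+i] i) ⟩
  2 ^ (3 + i) + 2 ^ (3 + i)  ≡⟨ cong (2 ^ (3 + i) +_) (+-identityʳ _) ⟨
  2 ^ (3 + suc i)            ∎
  where open ≤-Reasoning

-- For y = 2^j the condition `suc e ≤ 2 * y` reads 4 + j ≤ 2^j, which first holds at j = 3. Hence
-- the scale starts at x = 16 · 4³ = 4^5. All of x and s are powers of two, as the upper bound on
-- the lcm requires.
prime-between : ∀ i → ∃[ p ] Prime p × 4 ^ (5 + i) < p × p ≤ 4 ^ (7 + i)
prime-between i = prime-in-gap {x = 4 ^ (5 + i)} {s = 2 ^ (7 + i)} {y = 2 ^ (3 + i)} {X = 4 ^ (7 + i)} (13 + (i + i))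
  (subst (λ z → lcmUpTo z ≤ 2 ^ (2 * z)) (sym (4^≡2^ (5 + i))) (lcmUpTo-upper ((5 + i) + (5 + i))))
  (lcmUpTo-upper (7 + i))
  (m^n>0 2 (3 + i))
  (trans (^-distribˡ-+-* 4 2 (3 + i)) (cong (16 *_) (trans (4^≡2^ (3 + i)) (^-distribˡ-+-* 2 (3 + i) (3 + i)))))
  (^-distribˡ-+-* 2 4 (3 + i))
  (trans (4^≡2^ (7 + i)) (^-distribˡ-+-* 2 (7 + i) (7 + i)))
  (trans (4^≡2^ (7 + i)) (cong (2 ^_) (regroup i)))
  (≤-trans (≤-reflexive (doubled i)) (*-monoʳ-≤ 2 (7+i≤2^[3+i] i)))
  where
  4^≡2^ : ∀ n → 4 ^ n ≡ 2 ^ (n + n)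
  4^≡2^ n = trans (^-*-assoc 2 2 n) (cong (λ z → 2 ^ (n + z)) (+-identityʳ n))
  regroup : ∀ i → (7 + i) + (7 + i) ≡ 14 + (i + i)
  regroup = solve-∀
  doubled : ∀ i → 14 + (i + i) ≡ 2 * (7 + i)
  doubled = solve-∀

-- Moving one step up the scale whenever x overtakes it loses at most a factor 4; the further factor
-- `f 0` pays for the x below the start of the scale.
geometric-cover : (f : ℕ → ℕ) → (∀ i → 1 ≤ f i) → (∀ i → f (suc i) ≡ 4 * f i) →
                  ∀ x → ∃[ i ] suc x ≤ f i × f i ≤ 4 * f 0 * suc x
geometric-cover f f≥1 step zero    = 0 , f≥1 0 , ≤-trans (m≤n*m (f 0) 4) (≤-reflexive (sym (*-identityʳ _)))
geometric-cover f f≥1 step (suc x) with geometric-cover f f≥1 step x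
... | i , x≤ , ≤x with suc (suc x) ≤? f i
...   | yes sx≤ = i , sx≤ , ≤-trans ≤x (*-monoʳ-≤ (4 * f 0) (n≤1+n (suc x)))
...   | no  sx≰ = suc i , lower , upper
  where
  open ≤-Reasoning
  lower : suc (suc x) ≤ f (suc i)
  lower = begin
    1 + suc x        ≤⟨ +-mono-≤ (f≥1 i) x≤ ⟩
    f i + f i        ≤⟨ +-monoʳ-≤ (f i) (m≤m+n (f i) _) ⟩
    4 * f i          ≡⟨ step i ⟨
    f (suc i)        ∎
  upper : f (suc i) ≤ 4 * f 0 * suc (suc x)
  upper = begin
    f (suc i)                  ≡⟨ step i ⟩
    4 * f i                    ≤⟨ *-mono-≤ (m≤m*n 4 (f 0) {{>-nonZero (f≥1 0)}}) (<⇒≤ (≰⇒> sx≰)) ⟩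
    4 * f 0 * suc (suc x)      ∎

bertrand-along : (f : ℕ → ℕ) → (∀ i → 1 ≤ f i) → (∀ i → f (suc i) ≡ 4 * f i) → ∀ {r} → 1 ≤ r →
                 (∀ i → ∃[ p ] Prime p × f i < p × p ≤ r * f i) →
                 ∃[ B ] 1 ≤ B × (∀ x → 1 ≤ x → ∃[ p ] Prime p × x ≤ p × p ≤ B * x)
bertrand-along f f≥1 step {r} r≥1 primes = r * (4 * f 0) , *-mono-≤ r≥1 (*-mono-≤ (s≤s (z≤n {3})) (f≥1 0)) , between
  where
  between : ∀ x → 1 ≤ x → ∃[ p ] Prime p × x ≤ p × p ≤ r * (4 * f 0) * x
  between (suc x) _ with geometric-cover f f≥1 step x
  ... | i , x≤ , ≤x with primes i
  ...   | p , pr , <p , p≤ = p , pr , ≤-trans x≤ (<⇒≤ <p) ,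
    ≤-trans p≤ (≤-trans (*-monoʳ-≤ r ≤x) (≤-reflexive (sym (*-assoc r (4 * f 0) (suc x)))))

bertrand : ∃[ B ] 1 ≤ B × (∀ x → 1 ≤ x → ∃[ p ] Prime p × x ≤ p × p ≤ B * x)
bertrand = bertrand-along (λ i → 4 ^ (5 + i)) (λ i → m^n>0 4 (5 + i)) (λ i → refl) (m^n>0 4 2) λ i →
  let p , pr , <p , p≤ = prime-between i
  in  p , pr , <p , ≤-trans p≤ (≤-reflexive (^-distribˡ-+-* 4 2 (5 + i)))

-- Polynomials modulo a prime and Reed-Solomon codes.

Polynomial : ℕ → Set
Polynomial = Vec ℤ

eval : ∀ {n} → Polynomial n → ℤ → ℤ
eval []      x = 0ℤ
eval (c ∷ f) x = c ℤ.+ x ℤ.* eval f x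

-- quotient f a is the quotient of c ∷ f by X - a, for any constant coefficient c.
quotient : ∀ {n} → Polynomial n → ℤ → Polynomial n
quotient []      a = []
quotient (c ∷ f) a = eval (c ∷ f) a ∷ quotient f a

-- Synthetic division: the partial values of Horner's scheme at `a` are the coefficients of the
-- quotient. The identity holds over ℤ, before any reduction modulo q.
eval-quotient : ∀ {n} c (f : Polynomial n) a x →
  eval (c ∷ f) x ≡ eval (c ∷ f) a ℤ.+ (x ℤ.- a) ℤ.* eval (quotient f a) x
eval-quotient c []      a x = constant c a x
  where
  constant : ∀ c a x → c ℤ.+ x ℤ.* 0ℤ ≡ c ℤ.+ a ℤ.* 0ℤ ℤ.+ (x ℤ.- a) ℤ.* 0ℤ
  constant = solve-∀ℤ
eval-quotient c (b ∷ f) a x = trans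
  (cong (λ z → c ℤ.+ x ℤ.* z) (eval-quotient b f a x))
  (rearrange c a x (eval (b ∷ f) a) (eval (quotient f a) x))
  where
  rearrange : ∀ c a x u v → c ℤ.+ x ℤ.* (u ℤ.+ (x ℤ.- a) ℤ.* v) ≡
                            c ℤ.+ a ℤ.* u ℤ.+ (x ℤ.- a) ℤ.* (u ℤ.+ x ℤ.* v)
  rearrange = solve-∀ℤ

∣0 : ∀ d → d ℤ.∣ 0ℤ
∣0 d = ℤ.divides 0ℤ refl

∣eval : ∀ {d n} {f : Polynomial n} x → VecAll.All (d ℤ.∣_) f → d ℤ.∣ eval f x
∣eval x []         = ∣0 _
∣eval x (d∣c ∷ d∣f) = ℤ.∣m∣n⇒∣m+n d∣c (ℤ.∣n⇒∣m*n x (∣eval x d∣f))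

-- A coefficient is recovered from two successive Horner values, c = eval (c ∷ f) a - a * eval f a,
-- so divisibility propagates down from the leading coefficient.
∣quotient : ∀ {d n} (f : Polynomial n) a → VecAll.All (d ℤ.∣_) (quotient f a) → VecAll.All (d ℤ.∣_) f
∣quotient []      a []        = []
∣quotient (c ∷ f) a (d∣fa ∷ h) = ℤ.∣m+n∣n⇒∣m d∣fa (ℤ.∣n⇒∣m*n a (∣eval a d∣f)) ∷ d∣f
  where d∣f = ∣quotient f a h

euclidsLemmaℤ : ∀ {q} x y → Prime q → int q ℤ.∣ x ℤ.* y → int q ℤ.∣ x ⊎ int q ℤ.∣ y
euclidsLemmaℤ {q} x y pr q∣xy
  with euclidsLemma ℤ.∣ x ∣ ℤ.∣ y ∣ pr (subst (q ∣_) (ℤ.abs-* x y) (ℤ.∣⇒∣ᵤ q∣xy))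
... | inj₁ q∣x = inj₁ (ℤ.∣ᵤ⇒∣ q∣x)
... | inj₂ q∣y = inj₂ (ℤ.∣ᵤ⇒∣ q∣y)

-- A root `a` splits off a factor X - a, and the other roots pass to the quotient because q is prime
-- and divides no difference of two roots. Concluding that every coefficient vanishes modulo q
-- avoids any notion of degree or leading coefficient.
lagrange : ∀ {q n} → Prime q → (f : Polynomial n) (as : List ℤ) →
           AllPairs (λ a b → ¬ (int q ℤ.∣ b ℤ.- a)) as → All (λ a → int q ℤ.∣ eval f a) as →
           n ≤ length as → VecAll.All (int q ℤ.∣_) f
lagrange pr []      as       distinct      roots       n≤ = []
lagrange {q} pr (c ∷ f) (a ∷ as) (a≢ ∷ distinct) (root-a ∷ roots) (s≤s n≤) =
  ℤ.∣m+n∣n⇒∣m root-a (ℤ.∣n⇒∣m*n a (∣eval a q∣f)) ∷ q∣f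
  where
  root-quotient : ∀ {b} → ¬ (int q ℤ.∣ b ℤ.- a) × int q ℤ.∣ eval (c ∷ f) b → int q ℤ.∣ eval (quotient f a) b
  root-quotient {b} (b≢a , root-b)
    with euclidsLemmaℤ (b ℤ.- a) (eval (quotient f a) b) pr
           (ℤ.∣m+n∣m⇒∣n (subst (int q ℤ.∣_) (eval-quotient c f a b) root-b) root-a)
  ... | inj₁ q∣b-a = contradiction q∣b-a b≢a
  ... | inj₂ q∣g   = q∣g
  q∣f : VecAll.All (int q ℤ.∣_) f
  q∣f = ∣quotient f a (lagrange pr (quotient f a) as distinct (All.map root-quotient (All.zip (a≢ , roots))) n≤)

∣difference⇒≡ : ∀ {q x y} → x < q → y < q → int q ℤ.∣ int x ℤ.- int y → x ≡ y
∣difference⇒≡ {q} {x} {y} x<q y<q q∣ = ℤ.+-injective (ℤ.i-j≡0⇒i≡j (int x) (int y) (ℤ.∣i∣≡0⇒i≡0 abs≡0))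
  where
  abs<q : ℤ.∣ int x ℤ.- int y ∣ < q
  abs<q = ≤-<-trans (≤-reflexive (cong ℤ.∣_∣ (ℤ.[+m]-[+n]≡m⊖n x y)))
            (≤-<-trans (ℤ.∣m⊝n∣≤m⊔n x y) (⊔-lub x<q y<q))
  abs≡0 : ℤ.∣ int x ℤ.- int y ∣ ≡ 0
  abs≡0 with ℤ.∣ int x ℤ.- int y ∣ ≟ 0
  ... | yes eq = eq
  ... | no ≢0  = contradiction (∣⇒≤ {{≢-nonZero ≢0}} (ℤ.∣⇒∣ᵤ q∣)) (<⇒≱ abs<q)

%ℕ≡⇒∣difference : ∀ q .{{_ : NonZero q}} x y → x %ℕ q ≡ y %ℕ q → int q ℤ.∣ x ℤ.- y
%ℕ≡⇒∣difference q x y eq = ℤ.divides (x /ℕ q ℤ.- y /ℕ q) (trans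
  (cong₂ ℤ._-_ (a≡a%ℕn+[a/ℕn]*n x q) (trans (a≡a%ℕn+[a/ℕn]*n y q) (cong (λ r → int r ℤ.+ (y /ℕ q) ℤ.* int q) (sym eq))))
  (cancel (int (x %ℕ q)) (x /ℕ q) (y /ℕ q) (int q)))
  where
  cancel : ∀ r u v q → (r ℤ.+ u ℤ.* q) ℤ.- (r ℤ.+ v ℤ.* q) ≡ (u ℤ.- v) ℤ.* q
  cancel = solve-∀ℤ

-- Words over Fin q are read as polynomials over ℤ/q; a word is encoded by its values at
-- the points 0, 1, …, as in a Reed–Solomon code.
module ReedSolomon {q : ℕ} (q-prime : Prime q) where

  private instance
    q≢0 : NonZero q
    q≢0 = prime⇒nonZero q-prime

  toPolynomial : ∀ {n} → Vec (Fin q) n → Polynomial n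
  toPolynomial = Vec.map (λ c → int (toℕ c))

  value : ∀ {n} → Vec (Fin q) n → ℕ → Fin q
  value w a = fromℕ< (n%ℕd<d (eval (toPolynomial w) (int a)) q)

  difference : ∀ {n} → Vec (Fin q) n → Vec (Fin q) n → Polynomial n
  difference = Vec.zipWith (λ c c′ → int (toℕ c) ℤ.- int (toℕ c′))

  eval-difference : ∀ {n} (w w′ : Vec (Fin q) n) x →
    eval (difference w w′) x ≡ eval (toPolynomial w) x ℤ.- eval (toPolynomial w′) x
  eval-difference []      []        x = refl
  eval-difference (c ∷ w) (c′ ∷ w′) x = trans
    (cong (λ z → int (toℕ c) ℤ.- int (toℕ c′) ℤ.+ x ℤ.* z) (eval-difference w w′ x))
    (distribute (int (toℕ c)) (int (toℕ c′)) x (eval (toPolynomial w) x) (eval (toPolynomial w′) x))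
    where
    distribute : ∀ c c′ x u v → c ℤ.- c′ ℤ.+ x ℤ.* (u ℤ.- v) ≡ (c ℤ.+ x ℤ.* u) ℤ.- (c′ ℤ.+ x ℤ.* v)
    distribute = solve-∀ℤ

  value≡⇒∣ : ∀ {n} (w w′ : Vec (Fin q) n) a → value w a ≡ value w′ a → int q ℤ.∣ eval (difference w w′) (int a)
  value≡⇒∣ w w′ a eq = subst (int q ℤ.∣_) (sym (eval-difference w w′ (int a)))
    (%ℕ≡⇒∣difference q x y (Fin.fromℕ<-injective _ _ (n%ℕd<d x q) (n%ℕd<d y q) eq))
    where
    x y : ℤ
    x = eval (toPolynomial w) (int a)
    y = eval (toPolynomial w′) (int a)

  ∣difference-digit⇒≡ : {c c′ : Fin q} → int q ℤ.∣ int (toℕ c) ℤ.- int (toℕ c′) → c ≡ c′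
  ∣difference-digit⇒≡ {c} {c′} q∣ = Fin.toℕ-injective (∣difference⇒≡ (Fin.toℕ<n c) (Fin.toℕ<n c′) q∣)

  ∣difference⇒word≡ : ∀ {n} (w w′ : Vec (Fin q) n) → VecAll.All (int q ℤ.∣_) (difference w w′) → w ≡ w′
  ∣difference⇒word≡ []      []        []        = refl
  ∣difference⇒word≡ (c ∷ w) (c′ ∷ w′) (q∣ ∷ h) = cong₂ _∷_ (∣difference-digit⇒≡ q∣) (∣difference⇒word≡ w w′ h)

  -- Two words with the same tail differ by a constant, hence by the same amount at every point.
  -- This is why rows with equal `j` never share a slot.
  value-head-injective : ∀ {n} c c′ (w : Vec (Fin q) n) a → value (c ∷ w) a ≡ value (c′ ∷ w) a → c ≡ c′
  value-head-injective c c′ w a eq = ∣difference-digit⇒≡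
    (ℤ.∣m+n∣n⇒∣m (value≡⇒∣ (c ∷ w) (c′ ∷ w) a eq) (ℤ.∣n⇒∣m*n (int a) (subst (int q ℤ.∣_) (sym self) (∣0 (int q)))))
    where
    self : eval (difference w w) (int a) ≡ 0ℤ
    self = trans (eval-difference w w (int a)) (ℤ.+-inverseʳ (eval (toPolynomial w) (int a)))

  -- The difference polynomial has n + 1 coefficients, so n + 1 roots would make it vanish. The
  -- condition `d ≤ q` keeps the points distinct modulo q.
  agreement-bound : ∀ {n d} {w w′ : Vec (Fin q) (suc n)} → w ≢ w′ → d ≤ q → (as : List (Fin d)) → Unique as →
                    All (λ a → value w (toℕ a) ≡ value w′ (toℕ a)) as → length as ≤ n
  agreement-bound {n} {d} {w} {w′} w≢w′ d≤q as unique agree = ≮⇒≥ λ n<len → w≢w′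
    (∣difference⇒word≡ w w′ (lagrange q-prime (difference w w′) (List.map (λ a → int (toℕ a)) as) (distinct unique) (roots agree)
      (≤-trans n<len (≤-reflexive (sym (length-map (λ a → int (toℕ a)) as))))))
    where
    distinct : ∀ {as : List (Fin d)} → Unique as → AllPairs (λ a b → ¬ (int q ℤ.∣ b ℤ.- a)) (List.map (λ a → int (toℕ a)) as)
    distinct unique = AllPairs.map⁺ (AllPairs.map (λ a≢b q∣b-a → a≢b (sym (Fin.toℕ-injective
      (∣difference⇒≡ (<-≤-trans (Fin.toℕ<n _) d≤q) (<-≤-trans (Fin.toℕ<n _) d≤q) q∣b-a)))) unique)
    roots : ∀ {as : List (Fin d)} → All (λ a → value w (toℕ a) ≡ value w′ (toℕ a)) as →
            All (λ a → int q ℤ.∣ eval (difference w w′) a) (List.map (λ a → int (toℕ a)) as)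
    roots agree = All.map⁺ (All.map (λ {a} → value≡⇒∣ w w′ (toℕ a)) agree)

-- Base-q digits.

module Digits {c q : ℕ} (m : ℕ) (c≤ : c ≤ q ^ m) where

  digit : Fin c → Fin m → Fin q
  digit j = finToFun (inject≤ j c≤)

  digits : Fin c → Vec (Fin q) m
  digits j = Vec.tabulate (digit j)

  funToFin-cong : ∀ {m n} {f g : Fin m → Fin n} → f ≗ g → funToFin f ≡ funToFin g
  funToFin-cong {zero}  f≗g = refl
  funToFin-cong {suc m} f≗g = cong₂ Fin.combine (f≗g Fin.zero) (funToFin-cong (f≗g ∘ Fin.suc))

  digits-injective : ∀ {j j′} → digits j ≡ digits j′ → j ≡ j′
  digits-injective {j} {j′} eq = Fin.inject≤-injective c≤ c≤ j j′ (begin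
    inject≤ j c≤          ≡⟨ Fin.funToFin-finToFin {m} {q} (inject≤ j c≤) ⟨
    funToFin (digit j)    ≡⟨ funToFin-cong digit≡ ⟩
    funToFin (digit j′)   ≡⟨ Fin.funToFin-finToFin {m} {q} (inject≤ j′ c≤) ⟩
    inject≤ j′ c≤         ∎)
    where
    open ≡-Reasoning
    digit≡ : digit j ≗ digit j′
    digit≡ i = begin
      digit j i                 ≡⟨ lookup∘tabulate (digit j) i ⟨
      Vec.lookup (digits j) i   ≡⟨ cong (λ w → Vec.lookup w i) eq ⟩
      Vec.lookup (digits j′) i  ≡⟨ lookup∘tabulate (digit j′) i ⟩
      digit j′ i                ∎

-- Formulas over arbitrary variable types, and composition of encodings.

-- The literal (v , b) asserts that v has value b.
Lit : Set → Set
Lit V = V × Bool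

Formula : Set → Set
Formula V = List (List (Lit V))

Holds : {V : Set} → (V → Bool) → Lit V → Set
Holds ρ l = ρ (proj₁ l) ≡ proj₂ l

Sat : {V : Set} → (V → Bool) → Formula V → Set
Sat ρ = All (Any (Holds ρ))

sat? : {V : Set} (ρ : V → Bool) (φ : Formula V) → Dec (Sat ρ φ)
sat? ρ = All.all? (Any.any? (λ l → ρ (proj₁ l) Bool.≟ proj₂ l))

Sat-cong : {V : Set} {ρ ρ′ : V → Bool} → ρ ≗ ρ′ → ∀ {φ} → Sat ρ φ → Sat ρ′ φ
Sat-cong ρ≗ρ′ = All.map (Any.map (λ {l} eq → trans (sym (ρ≗ρ′ (proj₁ l))) eq))

rename : {V W : Set} → (V → W) → Formula V → Formula W
rename f = List.map (List.map (map₁ f))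

Sat-rename⁺ : {V W : Set} {ρ : W → Bool} (f : V → W) {φ : Formula V} → Sat (ρ ∘ f) φ → Sat ρ (rename f φ)
Sat-rename⁺ f = All.map⁺ ∘ All.map Any.map⁺

Sat-rename⁻ : {V W : Set} {ρ : W → Bool} (f : V → W) {φ : Formula V} → Sat ρ (rename f φ) → Sat (ρ ∘ f) φ
Sat-rename⁻ f = All.map Any.map⁻ ∘ All.map⁻

record Encoding (V : Set) (P : (V → Bool) → Set) (maxAux maxClauses : ℕ) : Set where
  field
    aux      : ℕ
    formula  : Formula (V ⊎ Fin aux)
    sound    : ∀ ρ → Sat ρ formula → P (ρ ∘ inj₁)
    complete : ∀ τ → P τ → ∃[ σ ] Sat [ τ , σ ] formula
    aux≤     : aux ≤ maxAux
    clauses≤ : length formula ≤ maxClauses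

reinterpret : ∀ {V P Q a c a′ c′} → (∀ ρ → P ρ → Q ρ) → (∀ ρ → Q ρ → P ρ) → a ≤ a′ → c ≤ c′ →
              Encoding V P a c → Encoding V Q a′ c′
reinterpret P⇒Q Q⇒P a≤ c≤ E = record
  { aux      = E.aux
  ; formula  = E.formula
  ; sound    = λ ρ sat → P⇒Q _ (E.sound ρ sat)
  ; complete = λ τ Qτ → E.complete τ (Q⇒P τ Qτ)
  ; aux≤     = ≤-trans E.aux≤ a≤
  ; clauses≤ = ≤-trans E.clauses≤ c≤
  }
  where module E = Encoding E

-- Every construction below is glued by this: a gadget `γ` introduces fresh variables `W`, and the
-- inputs of an encoding of `Q` are wired to old or fresh variables. It is enough that `γ` and `Q`
-- together imply `P`, and that `P` allows the fresh variables to be chosen so that both hold.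
reduction : ∀ {V U W : Set} {w a c} {P : (V → Bool) → Set} {Q : (U → Bool) → Set} →
            Fin w ↔ W → (γ : Formula (V ⊎ W)) (wire : U → V ⊎ W) →
            (∀ ρ → Sat ρ γ → Q (ρ ∘ wire) → P (ρ ∘ inj₁)) →
            (∀ τ → P τ → ∃[ σ ] Sat [ τ , σ ] γ × Q ([ τ , σ ] ∘ wire)) →
            Encoding U Q a c → Encoding V P (w + a) (length γ + c)
reduction {V} {U} {W} {w} ↔W γ wire γ-sound γ-complete E = record
  { aux      = w + E.aux
  ; formula  = rename place γ List.++ rename placeSub E.formula
  ; sound    = λ ρ sat → γ-sound (ρ ∘ place) (Sat-rename⁻ place (All.++⁻ˡ (rename place γ) sat))
                 (E.sound (ρ ∘ placeSub) (Sat-rename⁻ placeSub (All.++⁻ʳ (rename place γ) sat)))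
  ; complete = complete
  ; aux≤     = +-monoʳ-≤ w E.aux≤
  ; clauses≤ = ≤-trans (≤-reflexive (trans (length-++ (rename place γ))
                 (cong₂ _+_ (length-map _ γ) (length-map _ E.formula)))) (+-monoʳ-≤ (length γ) E.clauses≤)
  }
  where
  module E = Encoding E
  open Inverse ↔W using (to; from; strictlyInverseˡ)
  place : V ⊎ W → V ⊎ Fin (w + E.aux)
  place = Sum.map₂ (λ v → from v ↑ˡ E.aux)
  placeSub : U ⊎ Fin E.aux → V ⊎ Fin (w + E.aux)
  placeSub = [ place ∘ wire , inj₂ ∘ (w ↑ʳ_) ]
  complete : ∀ τ → _ → ∃[ σ ] Sat [ τ , σ ] (rename place γ List.++ rename placeSub E.formula)
  complete τ Pτ with γ-complete τ Pτ
  ... | σ , satγ , Qσ with E.complete _ Qσ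
  ...   | σ′ , satE = σ⊎σ′ , All.++⁺ (Sat-rename⁺ place (Sat-cong on-place satγ))
                                     (Sat-rename⁺ placeSub (Sat-cong on-placeSub satE))
    where
    σ⊎σ′ : Fin (w + E.aux) → Bool
    σ⊎σ′ = [ σ ∘ to , σ′ ] ∘ splitAt w
    on-place : [ τ , σ ] ≗ [ τ , σ⊎σ′ ] ∘ place
    on-place (inj₁ v) = refl
    on-place (inj₂ v) = sym (trans (cong [ σ ∘ to , σ′ ] (Fin.splitAt-↑ˡ w (from v) E.aux)) (cong σ (strictlyInverseˡ v)))
    on-placeSub : [ [ τ , σ ] ∘ wire , σ′ ] ≗ [ τ , σ⊎σ′ ] ∘ placeSub
    on-placeSub (inj₁ u) = on-place (wire u)
    on-placeSub (inj₂ i) = sym (cong [ σ ∘ to , σ′ ] (Fin.splitAt-↑ʳ w E.aux i))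

-- Adders and a counter of linear size.

bit : Bool → ℕ
bit b = if b then 1 else 0

total : ∀ {V : Set} {n} → (V → Bool) → Vec V n → ℕ
total ρ []       = 0
total ρ (x ∷ xs) = bit (ρ x) + total ρ xs

total-map : ∀ {V W : Set} {n} (ρ : W → Bool) (f : V → W) (xs : Vec V n) → total ρ (Vec.map f xs) ≡ total (ρ ∘ f) xs
total-map ρ f []       = refl
total-map ρ f (x ∷ xs) = cong (_ +_) (total-map ρ f xs)

-- Only the direction x + y + z ≤ s + 2 c is enforced.
fullAdder : {V : Set} → V → V → V → V → V → Formula V
fullAdder x y z s c =
  ((x , false) ∷ (s , true) ∷ (c , true) ∷ []) ∷
  ((y , false) ∷ (s , true) ∷ (c , true) ∷ []) ∷
  ((z , false) ∷ (s , true) ∷ (c , true) ∷ []) ∷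
  ((x , false) ∷ (y , false) ∷ (c , true) ∷ []) ∷
  ((x , false) ∷ (z , false) ∷ (c , true) ∷ []) ∷
  ((y , false) ∷ (z , false) ∷ (c , true) ∷ []) ∷
  ((x , false) ∷ (y , false) ∷ (z , false) ∷ (s , true) ∷ []) ∷ []

-- A truth table: taking the truth values themselves as variables, with assignment `id`, makes
-- `sat?` compute, so violating rows are refuted by an absurd pattern.
fullAdder-sound : ∀ x y z s c → True (sat? id (fullAdder x y z s c)) → bit x + (bit y + bit z) ≤ bit s + 2 * bit c
fullAdder-sound false false false _     _     _ = z≤n
fullAdder-sound false false true  false true  _ = s≤s z≤n
fullAdder-sound false false true  true  _     _ = s≤s z≤n
fullAdder-sound false true  false false true  _ = s≤s z≤n
fullAdder-sound false true  false true  _     _ = s≤s z≤n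
fullAdder-sound false true  true  false true  _ = s≤s (s≤s z≤n)
fullAdder-sound false true  true  true  true  _ = s≤s (s≤s z≤n)
fullAdder-sound true  false false false true  _ = s≤s z≤n
fullAdder-sound true  false false true  _     _ = s≤s z≤n
fullAdder-sound true  false true  false true  _ = s≤s (s≤s z≤n)
fullAdder-sound true  false true  true  true  _ = s≤s (s≤s z≤n)
fullAdder-sound true  true  false false true  _ = s≤s (s≤s z≤n)
fullAdder-sound true  true  false true  true  _ = s≤s (s≤s z≤n)
fullAdder-sound true  true  true  true  true  _ = s≤s (s≤s (s≤s z≤n))
fullAdder-sound false false true  false false ()
fullAdder-sound false true  false false false ()
fullAdder-sound false true  true  false false ()
fullAdder-sound false true  true  true  false ()
fullAdder-sound true  false false false false ()
fullAdder-sound true  false true  false false ()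
fullAdder-sound true  false true  true  false ()
fullAdder-sound true  true  false false false ()
fullAdder-sound true  true  false true  false ()
fullAdder-sound true  true  true  false false ()
fullAdder-sound true  true  true  false true  ()
fullAdder-sound true  true  true  true  false ()

fullAdder-complete : ∀ x y z → ∃[ s ] ∃[ c ]
  True (sat? id (fullAdder x y z s c)) × bit s + 2 * bit c ≡ bit x + (bit y + bit z)
fullAdder-complete false false false = false , false , _ , refl
fullAdder-complete false false true  = true  , false , _ , refl
fullAdder-complete false true  false = true  , false , _ , refl
fullAdder-complete false true  true  = false , true  , _ , refl
fullAdder-complete true  false false = true  , false , _ , refl
fullAdder-complete true  false true  = false , true  , _ , refl
fullAdder-complete true  true  false = false , true  , _ , refl
fullAdder-complete true  true  true  = true  , true  , _ , refl

halfAdder : {V : Set} → V → V → V → V → Formula V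
halfAdder x y s c =
  ((x , false) ∷ (s , true) ∷ (c , true) ∷ []) ∷
  ((y , false) ∷ (s , true) ∷ (c , true) ∷ []) ∷
  ((x , false) ∷ (y , false) ∷ (c , true) ∷ []) ∷ []

halfAdder-sound : ∀ x y s c → True (sat? id (halfAdder x y s c)) → bit x + bit y ≤ bit s + 2 * bit c
halfAdder-sound false false _     _     _ = z≤n
halfAdder-sound false true  false true  _ = s≤s z≤n
halfAdder-sound false true  true  _     _ = s≤s z≤n
halfAdder-sound true  false false true  _ = s≤s z≤n
halfAdder-sound true  false true  _     _ = s≤s z≤n
halfAdder-sound true  true  false true  _ = s≤s (s≤s z≤n)
halfAdder-sound true  true  true  true  _ = s≤s (s≤s z≤n)
halfAdder-sound false true  false false ()
halfAdder-sound true  false false false ()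
halfAdder-sound true  true  false false ()
halfAdder-sound true  true  true  false ()

halfAdder-complete : ∀ x y → ∃[ s ] ∃[ c ]
  True (sat? id (halfAdder x y s c)) × bit s + 2 * bit c ≡ bit x + bit y
halfAdder-complete false false = false , false , _ , refl
halfAdder-complete false true  = true  , false , _ , refl
halfAdder-complete true  false = true  , false , _ , refl
halfAdder-complete true  true  = false , true  , _ , refl

halve : ∀ k → ∃[ j ] (k ≡ 2 * j ⊎ k ≡ suc (2 * j))
halve zero    = 0 , inj₁ refl
halve (suc k) with halve k
... | j , inj₁ refl = j , inj₂ refl
... | j , inj₂ refl = suc j , inj₁ (cong suc (sym (+-suc j (j + 0))))

2m≤1+2n⇒m≤n : ∀ m {n} → 2 * m ≤ suc (2 * n) → m ≤ n
2m≤1+2n⇒m≤n m {n} h = ≮⇒≥ λ n<m → <⇒≱ (≤-trans (≤-reflexive (cong suc (sym (+-suc n (n + 0))))) (*-monoʳ-≤ 2 n<m)) h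

-- `xs` are the bits of the current weight and `cs` the carries collected for the next one.
WeightedAtMost : {V : Set} {n m : ℕ} → ℕ → Vec V n → Vec V m → (V → Bool) → Set
WeightedAtMost k xs cs ρ = total ρ xs + 2 * total ρ cs ≤ k

allFalse : ∀ {V : Set} {n} (xs : Vec V n) → Formula V
allFalse []       = []
allFalse (x ∷ xs) = ((x , false) ∷ []) ∷ allFalse xs

allFalse-sound : ∀ {V : Set} {n} (ρ : V → Bool) (xs : Vec V n) → Sat ρ (allFalse xs) → total ρ xs ≡ 0
allFalse-sound ρ []       []               = refl
allFalse-sound ρ (x ∷ xs) (here eq ∷ sat) rewrite eq = allFalse-sound ρ xs sat

allFalse-complete : ∀ {V : Set} {n} (ρ : V → Bool) (xs : Vec V n) → total ρ xs ≡ 0 → Sat ρ (allFalse xs)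
allFalse-complete ρ []       eq = []
allFalse-complete ρ (x ∷ xs) eq with ρ x in ρx
... | false = here ρx ∷ allFalse-complete ρ xs eq

length-allFalse : ∀ {V : Set} {n} (xs : Vec V n) → length (allFalse xs) ≡ n
length-allFalse []       = refl
length-allFalse (x ∷ xs) = cong suc (length-allFalse xs)

noneTrue : ∀ {V : Set} {n} (xs : Vec V n) → Encoding V (λ ρ → total ρ xs ≡ 0) 0 n
noneTrue xs = record
  { aux      = 0
  ; formula  = rename inj₁ (allFalse xs)
  ; sound    = λ ρ sat → allFalse-sound (ρ ∘ inj₁) xs (Sat-rename⁻ inj₁ sat)
  ; complete = λ τ eq → (λ ()) , Sat-rename⁺ inj₁ (allFalse-complete τ xs eq)
  ; aux≤     = z≤n
  ; clauses≤ = ≤-reflexive (trans (length-map _ (allFalse xs)) (length-allFalse xs))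
  }

total-++ : ∀ {V : Set} {n m} (ρ : V → Bool) (xs : Vec V n) (ys : Vec V m) →
           total ρ (xs Vec.++ ys) ≡ total ρ xs + total ρ ys
total-++ ρ []       ys = refl
total-++ ρ (x ∷ xs) ys = trans (cong (bit (ρ x) +_) (total-++ ρ xs ys)) (sym (+-assoc (bit (ρ x)) _ _))

half≤ : ∀ {j k f} → k ≡ 2 * j ⊎ k ≡ suc (2 * j) → k ≤ suc f → j ≤ f
half≤ {zero}  _           _         = z≤n
half≤ {suc j} (inj₁ refl) (s≤s le)  = ≤-trans (≤-trans (s≤s (m≤m+n j (j + 0))) (≤-reflexive (sym (+-suc j (j + 0))))) le
half≤ {suc j} (inj₂ refl) (s≤s le)  = ≤-trans (m≤m+n (suc j) _) le

2*half≤ : ∀ {j k} → k ≡ 2 * j ⊎ k ≡ suc (2 * j) → 2 * j ≤ k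
2*half≤ (inj₁ refl) = ≤-refl
2*half≤ (inj₂ refl) = n≤1+n _

≤1+2*half : ∀ {j k} → k ≡ 2 * j ⊎ k ≡ suc (2 * j) → k ≤ suc (2 * j)
≤1+2*half (inj₁ refl) = n≤1+n _
≤1+2*half (inj₂ refl) = ≤-refl

mutual
  -- Σ xs + 2 Σ cs ≤ k: adders turn the bits xs into one bit and carries, and once at most
  -- one bit is left everything is halved.
  counter : ∀ f {V : Set} {k n m} → k ≤ f → (xs : Vec V n) (cs : Vec V m) →
            Encoding V (WeightedAtMost k xs cs) (7 * (n + m + 2 * f)) (7 * (n + m + 2 * f))
  counter zero {n = n} {m} z≤n xs cs = reinterpret to from z≤n size (noneTrue (xs Vec.++ cs))
    where
    size : n + m ≤ 7 * (n + m + 2 * 0)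
    size = ≤-trans (m≤m+n (n + m) 0) (m≤n*m (n + m + 0) 7)
    to : ∀ ρ → total ρ (xs Vec.++ cs) ≡ 0 → WeightedAtMost 0 xs cs ρ
    to ρ eq = ≤-reflexive (cong₂ (λ a b → a + 2 * b) (m+n≡0⇒m≡0 (total ρ xs) eq′) (m+n≡0⇒n≡0 (total ρ xs) eq′))
      where
      eq′ : total ρ xs + total ρ cs ≡ 0
      eq′ = trans (sym (total-++ ρ xs cs)) eq
    from : ∀ ρ → WeightedAtMost 0 xs cs ρ → total ρ (xs Vec.++ cs) ≡ 0
    from ρ le = n≤0⇒n≡0 (≤-trans (≤-reflexive (total-++ ρ xs cs)) (≤-trans (+-monoʳ-≤ (total ρ xs) (m≤m+n (total ρ cs) _)) le))
  counter (suc f) {k = k} {m = m} k≤f [] cs with halve k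
  ... | j , k≡ = reinterpret to from size size (counter f (half≤ k≡ k≤f) cs [])
    where
    size : 7 * (m + 0 + 2 * f) ≤ 7 * (m + 2 * suc f)
    size = *-monoʳ-≤ 7 (+-mono-≤ (≤-reflexive (+-identityʳ m)) (*-monoʳ-≤ 2 (n≤1+n f)))
    to : ∀ ρ → total ρ cs + 0 ≤ j → 2 * total ρ cs ≤ k
    to ρ le = ≤-trans (*-monoʳ-≤ 2 (≤-trans (≤-reflexive (sym (+-identityʳ _))) le)) (2*half≤ {j} k≡)
    from : ∀ ρ → 2 * total ρ cs ≤ k → total ρ cs + 0 ≤ j
    from ρ le = ≤-trans (≤-reflexive (+-identityʳ _)) (2m≤1+2n⇒m≤n _ (≤-trans le (≤1+2*half {j} k≡)))
  counter (suc f) {m = m} k≤f (x ∷ []) cs = reinterpret (λ _ → id) (λ _ → id) size size (finish f k≤f x cs)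
    where
    size : 7 * (1 + m + 2 * f) ≤ 7 * (1 + m + 2 * suc f)
    size = *-monoʳ-≤ 7 (+-monoʳ-≤ (1 + m) (*-monoʳ-≤ 2 (n≤1+n f)))
  counter (suc f) {V} {k} {m = m} k≤f (x ∷ y ∷ []) cs =
    reinterpret (λ _ → id) (λ _ → id) (size₂ m f) (size₃ m f)
      (reduction (↔-id _) (halfAdder (inj₁ x) (inj₁ y) s c) id sound complete
        (finish f k≤f s (c ∷ Vec.map inj₁ cs)))
    where
    s c : V ⊎ Fin 2
    s = inj₂ Fin.zero
    c = inj₂ (Fin.suc Fin.zero)
    -- A half adder leaves n + m unchanged, but `finish` lowers f by one; the 14 released by 7 · 2 f
    -- pays for its three clauses.
    size₃ : ∀ m f → 3 + 7 * (1 + suc m + 2 * f) ≤ 7 * (2 + m + 2 * suc f)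
    size₃ m f = ≤-trans (m≤m+n _ 11) (≤-reflexive (regroup m f))
      where
      regroup : ∀ m f → 3 + 7 * (1 + suc m + 2 * f) + 11 ≡ 7 * (2 + m + 2 * suc f)
      regroup = solve-∀
    size₂ : ∀ m f → 2 + 7 * (1 + suc m + 2 * f) ≤ 7 * (2 + m + 2 * suc f)
    size₂ m f = ≤-trans (n≤1+n _) (size₃ m f)
    regroup : ∀ s c t → s + 0 + 2 * (c + t) ≡ s + 2 * c + 2 * t
    regroup = solve-∀
    regroup′ : ∀ a b t → a + (b + 0) + 2 * t ≡ a + b + 2 * t
    regroup′ = solve-∀
    value : ∀ ρ → WeightedAtMost k (s ∷ []) (c ∷ Vec.map inj₁ cs) ρ ≡ (bit (ρ s) + 2 * bit (ρ c) + 2 * total (ρ ∘ inj₁) cs ≤ k)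
    value ρ = cong (_≤ k) (trans (cong (λ t → bit (ρ s) + 0 + 2 * (bit (ρ c) + t)) (total-map ρ inj₁ cs))
                (regroup (bit (ρ s)) (bit (ρ c)) (total (ρ ∘ inj₁) cs)))
    value′ : ∀ τ → WeightedAtMost k (x ∷ y ∷ []) cs τ ≡ (bit (τ x) + bit (τ y) + 2 * total τ cs ≤ k)
    value′ τ = cong (_≤ k) (regroup′ (bit (τ x)) (bit (τ y)) (total τ cs))
    sound : ∀ ρ → Sat ρ (halfAdder (inj₁ x) (inj₁ y) s c) →
            WeightedAtMost k (s ∷ []) (c ∷ Vec.map inj₁ cs) ρ → WeightedAtMost k (x ∷ y ∷ []) cs (ρ ∘ inj₁)
    sound ρ sat le = subst id (sym (value′ (ρ ∘ inj₁))) (≤-trans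
      (+-monoˡ-≤ (2 * total (ρ ∘ inj₁) cs)
        -- Renaming along `ρ` itself turns the formula into its instance over truth values.
        (halfAdder-sound (ρ (inj₁ x)) (ρ (inj₁ y)) (ρ s) (ρ c) (fromWitness (Sat-rename⁺ {ρ = id} ρ sat))))
      (subst id (value ρ) le))
    complete : ∀ τ → WeightedAtMost k (x ∷ y ∷ []) cs τ →
               ∃[ σ ] Sat [ τ , σ ] (halfAdder (inj₁ x) (inj₁ y) s c) × WeightedAtMost k (s ∷ []) (c ∷ Vec.map inj₁ cs) [ τ , σ ]
    complete τ le with halfAdder-complete (τ x) (τ y)
    ... | sum , carry , sat , eq = σ , Sat-rename⁻ {ρ = id} [ τ , σ ] (toWitness sat) ,
      subst id (sym (value [ τ , σ ])) (≤-trans (≤-reflexive (cong (_+ 2 * total τ cs) eq)) (subst id (value′ τ) le))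
      where
      σ : Fin 2 → Bool
      σ Fin.zero    = sum
      σ (Fin.suc _) = carry
  counter (suc f) {V} {k} {suc (suc (suc n))} {m} k≤f (x ∷ y ∷ z ∷ xs) cs =
    reinterpret (λ _ → id) (λ _ → id) (size₂ n m f) (size₇ n m f)
      (reduction (↔-id _) (fullAdder (inj₁ x) (inj₁ y) (inj₁ z) s c) id sound complete
        (counter (suc f) k≤f (s ∷ Vec.map inj₁ xs) (c ∷ Vec.map inj₁ cs)))
    where
    s c : V ⊎ Fin 2
    s = inj₂ Fin.zero
    c = inj₂ (Fin.suc Fin.zero)
    -- Three bits become one bit and one carry, so n + m falls by one and pays exactly for the seven
    -- clauses.
    size₇ : ∀ n m f → 7 + 7 * (suc n + suc m + 2 * suc f) ≤ 7 * (3 + n + m + 2 * suc f)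
    size₇ n m f = ≤-reflexive (regroup n m f)
      where
      regroup : ∀ n m f → 7 + 7 * (suc n + suc m + 2 * suc f) ≡ 7 * (3 + n + m + 2 * suc f)
      regroup = solve-∀
    size₂ : ∀ n m f → 2 + 7 * (suc n + suc m + 2 * suc f) ≤ 7 * (3 + n + m + 2 * suc f)
    size₂ n m f = ≤-trans (+-monoˡ-≤ _ (m≤m+n 2 5)) (size₇ n m f)
    regroup : ∀ s c r t → s + r + 2 * (c + t) ≡ s + 2 * c + (r + 2 * t)
    regroup = solve-∀
    regroup′ : ∀ a b d r t → a + (b + (d + r)) + 2 * t ≡ a + (b + d) + (r + 2 * t)
    regroup′ = solve-∀
    rest : (V → Bool) → ℕ
    rest τ = total τ xs + 2 * total τ cs
    value : ∀ ρ → WeightedAtMost k (s ∷ Vec.map inj₁ xs) (c ∷ Vec.map inj₁ cs) ρ ≡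
                  (bit (ρ s) + 2 * bit (ρ c) + rest (ρ ∘ inj₁) ≤ k)
    value ρ = cong (_≤ k) (trans
      (cong₂ (λ r t → bit (ρ s) + r + 2 * (bit (ρ c) + t)) (total-map ρ inj₁ xs) (total-map ρ inj₁ cs))
      (regroup (bit (ρ s)) (bit (ρ c)) (total (ρ ∘ inj₁) xs) (total (ρ ∘ inj₁) cs)))
    value′ : ∀ τ → WeightedAtMost k (x ∷ y ∷ z ∷ xs) cs τ ≡ (bit (τ x) + (bit (τ y) + bit (τ z)) + rest τ ≤ k)
    value′ τ = cong (_≤ k) (regroup′ (bit (τ x)) (bit (τ y)) (bit (τ z)) (total τ xs) (total τ cs))
    sound : ∀ ρ → Sat ρ (fullAdder (inj₁ x) (inj₁ y) (inj₁ z) s c) →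
            WeightedAtMost k (s ∷ Vec.map inj₁ xs) (c ∷ Vec.map inj₁ cs) ρ →
            WeightedAtMost k (x ∷ y ∷ z ∷ xs) cs (ρ ∘ inj₁)
    sound ρ sat le = subst id (sym (value′ (ρ ∘ inj₁))) (≤-trans
      (+-monoˡ-≤ (rest (ρ ∘ inj₁))
        (fullAdder-sound (ρ (inj₁ x)) (ρ (inj₁ y)) (ρ (inj₁ z)) (ρ s) (ρ c) (fromWitness (Sat-rename⁺ {ρ = id} ρ sat))))
      (subst id (value ρ) le))
    complete : ∀ τ → WeightedAtMost k (x ∷ y ∷ z ∷ xs) cs τ →
               ∃[ σ ] Sat [ τ , σ ] (fullAdder (inj₁ x) (inj₁ y) (inj₁ z) s c) ×
                      WeightedAtMost k (s ∷ Vec.map inj₁ xs) (c ∷ Vec.map inj₁ cs) [ τ , σ ]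
    complete τ le with fullAdder-complete (τ x) (τ y) (τ z)
    ... | sum , carry , sat , eq = σ , Sat-rename⁻ {ρ = id} [ τ , σ ] (toWitness sat) ,
      subst id (sym (value [ τ , σ ])) (≤-trans (≤-reflexive (cong (_+ rest τ) eq)) (subst id (value′ τ) le))
      where
      σ : Fin 2 → Bool
      σ Fin.zero    = sum
      σ (Fin.suc _) = carry

  -- Parity decides what happens to the last bit. If k = 2 j, then x + 2 Σ cs ≤ 2 j is equivalent to
  -- x + Σ cs ≤ j, so x is promoted to the next weight; if k = 2 j + 1, the bit fits into the odd
  -- unit and is dropped.
  finish : ∀ f {V : Set} {k m} → k ≤ suc f → (x : V) (cs : Vec V m) →
           Encoding V (WeightedAtMost k (x ∷ []) cs) (7 * (1 + m + 2 * f)) (7 * (1 + m + 2 * f))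
  finish f {k = k} {m} k≤f x cs with halve k
  ... | j , k≡@(inj₁ refl) = reinterpret to from size size (counter f (half≤ k≡ k≤f) (x ∷ cs) [])
    where
    size : 7 * (suc m + 0 + 2 * f) ≤ 7 * (1 + m + 2 * f)
    size = ≤-reflexive (cong (λ z → 7 * (suc z + 2 * f)) (+-identityʳ m))
    to : ∀ ρ → bit (ρ x) + total ρ cs + 0 ≤ j → bit (ρ x) + 0 + 2 * total ρ cs ≤ 2 * j
    to ρ le = ≤-trans (≤-trans (m≤m+n _ (bit (ρ x))) (≤-reflexive (regroup (bit (ρ x)) (total ρ cs)))) (*-monoʳ-≤ 2 le)
      where
      regroup : ∀ b t → b + 0 + 2 * t + b ≡ 2 * (b + t + 0)
      regroup = solve-∀
    from : ∀ ρ → bit (ρ x) + 0 + 2 * total ρ cs ≤ 2 * j → bit (ρ x) + total ρ cs + 0 ≤ j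
    from ρ le with ρ x
    ... | false = ≤-trans (≤-reflexive (+-identityʳ _)) (*-cancelˡ-≤ 2 le)
    ... | true  = ≤-trans (≤-reflexive (+-identityʳ _)) (*-cancelˡ-< 2 _ _ le)
  ... | j , k≡@(inj₂ refl) = reinterpret to from size size (counter f (half≤ k≡ k≤f) cs [])
    where
    size : 7 * (m + 0 + 2 * f) ≤ 7 * (1 + m + 2 * f)
    size = *-monoʳ-≤ 7 (≤-trans (≤-reflexive (cong (_+ 2 * f) (+-identityʳ m))) (n≤1+n _))
    to : ∀ ρ → total ρ cs + 0 ≤ j → bit (ρ x) + 0 + 2 * total ρ cs ≤ suc (2 * j)
    to ρ le = +-mono-≤ (bit≤1 (ρ x)) (*-monoʳ-≤ 2 (≤-trans (≤-reflexive (sym (+-identityʳ _))) le))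
      where
      bit≤1 : ∀ b → bit b + 0 ≤ 1
      bit≤1 false = z≤n
      bit≤1 true  = ≤-refl
    from : ∀ ρ → bit (ρ x) + 0 + 2 * total ρ cs ≤ suc (2 * j) → total ρ cs + 0 ≤ j
    from ρ le = ≤-trans (≤-reflexive (+-identityʳ _)) (2m≤1+2n⇒m≤n _ (≤-trans (m≤n+m (2 * total ρ cs) (bit (ρ x) + 0)) le))

-- Counting by injections, and a union bound.

countTrue≤n : ∀ {n} (τ : Fin n → Bool) → countTrue τ ≤ n
countTrue≤n {zero}  τ = z≤n
countTrue≤n {suc n} τ with τ Fin.zero
... | false = m≤n⇒m≤1+n (countTrue≤n (τ ∘ Fin.suc))
... | true  = s≤s (countTrue≤n (τ ∘ Fin.suc))

countTrue-remove : ∀ {n} (σ : Fin n → Bool) u → σ u ≡ true → countTrue σ ≡ suc (countTrue (updateAt σ u (const false)))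
countTrue-remove {suc n} σ Fin.zero    eq rewrite eq = refl
countTrue-remove {suc n} σ (Fin.suc u) eq = trans
  (cong (bit (σ Fin.zero) +_) (countTrue-remove (σ ∘ Fin.suc) u eq)) (+-suc (bit (σ Fin.zero)) _)

-- The image of the first true position is switched off in `σ`; by injectivity the remaining images
-- stay true.
countTrue-injection : ∀ {n N} (τ : Fin n → Bool) (σ : Fin N → Bool) (g : ∀ i → τ i ≡ true → Fin N) →
  (∀ i p → σ (g i p) ≡ true) → (∀ i i′ p p′ → g i p ≡ g i′ p′ → i ≡ i′) → countTrue τ ≤ countTrue σ
countTrue-injection {zero}  τ σ g true-g inj = z≤n
countTrue-injection {suc n} τ σ g true-g inj with τ Fin.zero in eq
... | false = countTrue-injection (τ ∘ Fin.suc) σ (λ i → g (Fin.suc i)) (λ i → true-g (Fin.suc i))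
                (λ i i′ p p′ e → Fin.suc-injective (inj _ _ p p′ e))
... | true  = ≤-trans (s≤s (countTrue-injection (τ ∘ Fin.suc) (updateAt σ u (const false)) (λ i → g (Fin.suc i))
                (λ i p → trans (updateAt-minimal (g (Fin.suc i) p) u σ (λ e → suc≢zero (inj _ _ p eq e))) (true-g (Fin.suc i) p))
                (λ i i′ p p′ e → Fin.suc-injective (inj _ _ p p′ e))))
                (≤-reflexive (sym (countTrue-remove σ u (true-g Fin.zero eq))))
  where
  u : Fin _
  u = g Fin.zero eq
  suc≢zero : ∀ {i : Fin n} → Fin.suc i ≢ Fin.zero
  suc≢zero ()

length-filter-complement : ∀ {A : Set} {P : A → Set} (P? : ∀ a → Dec (P a)) (as : List A) →
  length as ≡ length (filter P? as) + length (filter (λ a → ¬? (P? a)) as)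
length-filter-complement P? []       = refl
length-filter-complement P? (a ∷ as) with P? a
... | yes _ = cong suc (length-filter-complement P? as)
... | no  _ = trans (cong suc (length-filter-complement P? as)) (sym (+-suc _ _))

-- A union bound: every true index spoils at most m candidates, which are filtered out index by
-- index, and more than m per true index were there at the start.
avoid : ∀ {n m} {A : Set} (τ : Fin n → Bool) {Bad : Fin n → A → Set} (bad? : ∀ i a → Dec (Bad i a)) →
        (∀ i as → Unique as → All (Bad i) as → length as ≤ m) →
        ∀ as → Unique as → countTrue τ * m < length as →
        ∃[ a ] a ∈ as × (∀ i → τ i ≡ true → ¬ Bad i a)
avoid {zero}  τ bad? few (a ∷ as) unique large = a , here refl , λ ()
avoid {suc n} {m} τ {Bad} bad? few as unique large with τ Fin.zero in eq
... | false with avoid (τ ∘ Fin.suc) (λ i → bad? (Fin.suc i)) (λ i → few (Fin.suc i)) as unique large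
...   | a , a∈ , good = a , a∈ , λ where
        Fin.zero    p → contradiction (trans (sym p) eq) λ ()
        (Fin.suc i) p → good i p
avoid {suc n} {m} τ {Bad} bad? few as unique large | true
  with avoid (τ ∘ Fin.suc) (λ i → bad? (Fin.suc i)) (λ i → few (Fin.suc i)) as′
         (Unique.filter⁺ (λ a → ¬? (bad? Fin.zero a)) unique) large′
  where
  as′ : List _
  as′ = filter (λ a → ¬? (bad? Fin.zero a)) as
  large′ : countTrue (τ ∘ Fin.suc) * m < length as′
  large′ = +-cancelˡ-< m _ _ (≤-trans large (≤-trans
    (≤-reflexive (length-filter-complement (bad? Fin.zero) as))
    (+-monoˡ-≤ (length as′) (few Fin.zero _ (Unique.filter⁺ (bad? Fin.zero) unique) (All.all-filter (bad? Fin.zero) as)))))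
... | a , a∈ , good with ∈-filter⁻ (λ a → ¬? (bad? Fin.zero a)) a∈
...   | a∈as , ¬bad = a , a∈as , λ where
        Fin.zero    p → ¬bad
        (Fin.suc i) p → good i p

-- Implication clauses and clause families over finite index types.

does⇒ : ∀ {P : Set} (P? : Dec P) → does P? ≡ true → P
does⇒ (yes p) _ = p

module _ {V : Set} {ρ : V → Bool} where

  implies⁺ : ∀ {u v b} → (ρ u ≡ true → ρ v ≡ b) → Any (Holds ρ) ((u , false) ∷ (v , b) ∷ [])
  implies⁺ {u} h with ρ u in eq
  ... | false = here eq
  ... | true  = there (here (h refl))

  implies⁻ : ∀ {u v b} → Any (Holds ρ) ((u , false) ∷ (v , b) ∷ []) → ρ u ≡ true → ρ v ≡ b
  implies⁻ (here ¬u)         u = contradiction (trans (sym u) ¬u) λ ()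
  implies⁻ (there (here v)) u = v

  implies₂⁺ : ∀ {u v w b} → (ρ u ≡ true → ρ v ≡ true → ρ w ≡ b) →
              Any (Holds ρ) ((u , false) ∷ (v , false) ∷ (w , b) ∷ [])
  implies₂⁺ {u} h with ρ u in eq
  ... | false = here eq
  ... | true  = there (implies⁺ (h refl))

  implies₂⁻ : ∀ {u v w b} → Any (Holds ρ) ((u , false) ∷ (v , false) ∷ (w , b) ∷ []) →
              ρ u ≡ true → ρ v ≡ true → ρ w ≡ b
  implies₂⁻ (here ¬u)  u v = contradiction (trans (sym u) ¬u) λ ()
  implies₂⁻ (there h)  u v = implies⁻ h v

clauses : ∀ {I V : Set} {m} → Fin m ↔ I → (I → List (Lit V)) → Formula V
clauses enum cl = List.tabulate (cl ∘ Inverse.to enum)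

module _ {I V : Set} {m} (enum : Fin m ↔ I) {cl : I → List (Lit V)} {ρ : V → Bool} where

  clauses⁺ : (∀ i → Any (Holds ρ) (cl i)) → Sat ρ (clauses enum cl)
  clauses⁺ h = All.tabulate⁺ (h ∘ Inverse.to enum)

  clauses⁻ : Sat ρ (clauses enum cl) → ∀ i → Any (Holds ρ) (cl i)
  clauses⁻ sat i = subst (λ z → Any (Holds ρ) (cl z)) (Inverse.strictlyInverseˡ enum i)
    (All.tabulate⁻ sat (Inverse.from enum i))

length-clauses : ∀ {I V : Set} {m} (enum : Fin m ↔ I) (cl : I → List (Lit V)) → length (clauses enum cl) ≡ m
length-clauses enum cl = length-tabulate (cl ∘ Inverse.to enum)

clauses-++ : ∀ {I V : Set} {m} (enum : Fin m ↔ I) (cl : I → List (Lit V)) {φ l} →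
             length φ ≡ l → length (clauses enum cl List.++ φ) ≡ m + l
clauses-++ enum cl eq = trans (length-++ (clauses enum cl)) (cong₂ _+_ (length-clauses enum cl) eq)

atMostLinear : ∀ k N → Encoding (Fin N) (AtMostK k N) (7 * (N + 2 * k)) (7 * (N + 2 * k))
atMostLinear k N = reinterpret (λ ρ → subst (_≤ k) (total≡ ρ)) (λ ρ → subst (_≤ k) (sym (total≡ ρ))) size size
  (counter k ≤-refl (Vec.allFin N) [])
  where
  size : 7 * (N + 0 + 2 * k) ≤ 7 * (N + 2 * k)
  size = ≤-reflexive (cong (λ z → 7 * (z + 2 * k)) (+-identityʳ N))
  total-tabulate : ∀ {N M} (ρ : Fin M → Bool) (f : Fin N → Fin M) → total ρ (Vec.tabulate f) ≡ countTrue (ρ ∘ f)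
  total-tabulate {zero}  ρ f = refl
  total-tabulate {suc N} ρ f = cong (bit (ρ (f Fin.zero)) +_) (total-tabulate ρ (f ∘ Fin.suc))
  total≡ : ∀ ρ → total ρ (Vec.allFin N) + 0 ≡ countTrue ρ
  total≡ ρ = trans (+-identityʳ _) (total-tabulate ρ id)

-- Translation to the literals and CNFs of the statement.

toLiteral : ∀ {v} → Lit (Fin v) → Literal v
toLiteral (v , true)  = pos v
toLiteral (v , false) = neg v

toCNF : ∀ {v} → Formula (Fin v) → CNF v
toCNF = List.map (List.map toLiteral)

holds⇒evalLit : ∀ {v} {ρ : Fin v → Bool} {l} → Holds ρ l → evalLit ρ (toLiteral l) ≡ true
holds⇒evalLit {l = v , true}  eq = eq
holds⇒evalLit {l = v , false} eq = cong not eq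

evalLit⇒holds : ∀ {v} {ρ : Fin v → Bool} {l} → evalLit ρ (toLiteral l) ≡ true → Holds ρ l
evalLit⇒holds         {l = v , true}  eq = eq
evalLit⇒holds {ρ = ρ} {l = v , false} eq = Bool.not-injective eq

encodes : ∀ {n k a c} → Encoding (Fin n) (AtMostK k n) a c →
          ∃[ a′ ] ∃[ φ ] Encodes n a′ (AtMostK k n) φ × a′ ≤ a × length φ ≤ c
encodes {n} {k} E = E.aux , toCNF (rename index E.formula) , (λ τ → mk⇔ (to τ) (from τ)) , E.aux≤ ,
  ≤-trans (≤-reflexive (trans (length-map _ (rename index E.formula)) (length-map _ E.formula))) E.clauses≤
  where
  module E = Encoding E
  index : Fin n ⊎ Fin E.aux → Fin (n + E.aux)
  index = Fin.join n E.aux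
  _⊕_ : (Fin n → Bool) → (Fin E.aux → Bool) → Fin (n + E.aux) → Bool
  τ ⊕ σ = τ Functional.++ σ
  split : ∀ τ σ → (τ ⊕ σ) ∘ index ≗ [ τ , σ ]
  split τ σ v = cong [ τ , σ ] (Fin.splitAt-join n E.aux v)
  to : ∀ τ → AtMostK k n τ → ∃[ σ ] SatCNF (τ ⊕ σ) (toCNF (rename index E.formula))
  to τ le with E.complete τ le
  ... | σ , sat = σ , All.map⁺ (All.map (Any.map⁺ ∘ Any.map holds⇒evalLit)
                        (Sat-rename⁺ index (Sat-cong (sym ∘ split τ σ) sat)))
  from : ∀ τ → ∃[ σ ] SatCNF (τ ⊕ σ) (toCNF (rename index E.formula)) → AtMostK k n τ
  from τ (σ , sat) = E.sound [ τ , σ ] (Sat-cong (split τ σ) (Sat-rename⁻ index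
    (All.map (Any.map evalLit⇒holds ∘ Any.map⁻) (All.map⁻ sat))))

-- The grid gadget for an abstract code.

module GridEncoding
  {n k c q d m : ℕ}
  (n≤ : n ≤ c * q * c) (km<d : k * m < d)
  (code : Fin c × Fin q → Fin d → Fin q)
  (code-injective : ∀ j {b b′} a → code (j , b) a ≡ code (j , b′) a → b ≡ b′)
  (code-agreement : ∀ {r r′} → r ≢ r′ → ∀ as → Unique as → All (λ a → code r a ≡ code r′ a) as → length as ≤ m)
  where

  Row Slot Cell : Set
  Row  = Fin c × Fin q
  Slot = Fin d × Fin q
  Cell = Slot × Fin c

  _≟Row_ : (r r′ : Row) → Dec (r ≡ r′)
  _≟Row_ = ≡-dec Fin._≟_ Fin._≟_

  _≟Slot_ : (s s′ : Slot) → Dec (s ≡ s′)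
  _≟Slot_ = ≡-dec Fin._≟_ Fin._≟_

  enumRow : Fin (c * q) ↔ Row
  enumRow = Fin.*↔×

  enumSlot : Fin (d * q) ↔ Slot
  enumSlot = Fin.*↔×

  enumCell : Fin (d * q * c) ↔ Cell
  enumCell = (enumSlot ×-↔ ↔-id _) ↔-∘ Fin.*↔×

  enumGrid : Fin (c * q * c) ↔ (Row × Fin c)
  enumGrid = (enumRow ×-↔ ↔-id _) ↔-∘ Fin.*↔×

  position : Fin n → Row × Fin c
  position i = Inverse.to enumGrid (inject≤ i n≤)

  row : Fin n → Row
  row i = proj₁ (position i)

  col : Fin n → Fin c
  col i = proj₂ (position i)

  position-injective : ∀ {i i′} → row i ≡ row i′ → col i ≡ col i′ → i ≡ i′
  position-injective {i} {i′} row≡ col≡ = Fin.inject≤-injective n≤ n≤ i i′ (trans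
    (sym (Inverse.strictlyInverseʳ enumGrid (inject≤ i n≤)))
    (trans (cong (Inverse.from enumGrid) (cong₂ _,_ row≡ col≡)) (Inverse.strictlyInverseʳ enumGrid (inject≤ i′ n≤))))

  slotAt : Row → Fin d → Slot
  slotAt r a = a , code r a

  -- ladder (s , t) stands for j < t, where (j , b) is the row owning slot s; rows with equal
  -- j never share a slot, so the owner is determined by j.
  Aux : Set
  Aux = Row ⊎ (Cell ⊎ (Slot ⊎ Slot × Fin (suc c)))

  #aux : ℕ
  #aux = c * q + (d * q * c + (d * q + d * q * suc c))

  enumAux : Fin #aux ↔ Aux
  enumAux = (enumRow ⊎-↔ ((enumCell ⊎-↔ ((enumSlot ⊎-↔ ((enumSlot ×-↔ ↔-id _) ↔-∘ Fin.*↔×)) ↔-∘ Fin.+↔⊎)) ↔-∘ Fin.+↔⊎)) ↔-∘ Fin.+↔⊎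

  Var : Set
  Var = Fin n ⊎ Aux

  item : Fin n → Var
  item = inj₁

  rowUsed : Row → Var
  rowUsed = inj₂ ∘ inj₁

  cellUsed : Cell → Var
  cellUsed = inj₂ ∘ inj₂ ∘ inj₁

  slotUsed : Slot → Var
  slotUsed = inj₂ ∘ inj₂ ∘ inj₂ ∘ inj₁

  ladder : Slot × Fin (suc c) → Var
  ladder = inj₂ ∘ inj₂ ∘ inj₂ ∘ inj₂

  enumRowPoint : Fin (c * q * d) ↔ (Row × Fin d)
  enumRowPoint = (enumRow ×-↔ ↔-id _) ↔-∘ Fin.*↔×

  -- These two families make up the 2 n; all others are indexed by cells or by pairs of a row and a
  -- point.
  itemRow itemCells : Fin n → List (Lit Var)
  itemRow i   = (item i , false) ∷ (rowUsed (row i) , true) ∷ []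
  itemCells i = (item i , false) ∷ List.tabulate (λ a → cellUsed (slotAt (row i) a , col i) , true)

  cellSlot ladderStep : Cell → List (Lit Var)
  cellSlot (s , y)   = (cellUsed (s , y) , false) ∷ (slotUsed s , true) ∷ []
  ladderStep (s , j) = (ladder (s , inject₁ j) , false) ∷ (ladder (s , Fin.suc j) , true) ∷ []

  -- Together they force the ladder of a used slot to switch from false to true exactly at the j of
  -- each used row through it. A monotone ladder switches once, so j is determined.
  ownerBelow ownerNotBelow : Row × Fin d → List (Lit Var)
  ownerBelow (r , a)    = (rowUsed r , false) ∷ (slotUsed (slotAt r a) , false) ∷ (ladder (slotAt r a , Fin.suc (proj₁ r)) , true) ∷ []
  ownerNotBelow (r , a) = (rowUsed r , false) ∷ (slotUsed (slotAt r a) , false) ∷ (ladder (slotAt r a , inject₁ (proj₁ r)) , false) ∷ []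

  gadget : Formula Var
  gadget = clauses (↔-id _) itemRow List.++ clauses (↔-id _) itemCells List.++
    clauses enumCell cellSlot List.++ clauses enumCell ladderStep List.++
    clauses enumRowPoint ownerBelow List.++ clauses enumRowPoint ownerNotBelow

  length-gadget : length gadget ≡ n + (n + (d * q * c + (d * q * c + (c * q * d + c * q * d))))
  length-gadget =
    clauses-++ (↔-id _) itemRow (clauses-++ (↔-id _) itemCells
    (clauses-++ enumCell cellSlot (clauses-++ enumCell ladderStep
    (clauses-++ enumRowPoint ownerBelow (length-clauses enumRowPoint ownerNotBelow)))))

  wire : Fin (d * q * c) → Var
  wire = cellUsed ∘ Inverse.to enumCell

  module Sound (ρ : Var → Bool) (sat : Sat ρ gadget) where

    private
      rest₁ = All.++⁻ʳ (clauses (↔-id _) itemRow) sat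
      rest₂ = All.++⁻ʳ (clauses (↔-id _) itemCells) rest₁
      rest₃ = All.++⁻ʳ (clauses enumCell cellSlot) rest₂
      rest₄ = All.++⁻ʳ (clauses enumCell ladderStep) rest₃

    item⇒row : ∀ i → ρ (item i) ≡ true → ρ (rowUsed (row i)) ≡ true
    item⇒row i = implies⁻ (clauses⁻ (↔-id _) (All.++⁻ˡ (clauses (↔-id _) itemRow) sat) i)

    item⇒cell : ∀ i → ρ (item i) ≡ true → ∃[ a ] ρ (cellUsed (slotAt (row i) a , col i)) ≡ true
    item⇒cell i p with clauses⁻ (↔-id _) (All.++⁻ˡ (clauses (↔-id _) itemCells) rest₁) i
    ... | here ¬p   = contradiction (trans (sym p) ¬p) λ ()
    ... | there any = Any.tabulate⁻ any

    cell⇒slot : ∀ s y → ρ (cellUsed (s , y)) ≡ true → ρ (slotUsed s) ≡ true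
    cell⇒slot s y = implies⁻ (clauses⁻ enumCell (All.++⁻ˡ (clauses enumCell cellSlot) rest₂) (s , y))

    ladder-step : ∀ s j → ρ (ladder (s , inject₁ j)) ≡ true → ρ (ladder (s , Fin.suc j)) ≡ true
    ladder-step s j = implies⁻ (clauses⁻ enumCell (All.++⁻ˡ (clauses enumCell ladderStep) rest₃) (s , j))

    owner-below : ∀ r a → ρ (rowUsed r) ≡ true → ρ (slotUsed (slotAt r a)) ≡ true →
                  ρ (ladder (slotAt r a , Fin.suc (proj₁ r))) ≡ true
    owner-below r a = implies₂⁻ (clauses⁻ enumRowPoint (All.++⁻ˡ (clauses enumRowPoint ownerBelow) rest₄) (r , a))

    owner-not-below : ∀ r a → ρ (rowUsed r) ≡ true → ρ (slotUsed (slotAt r a)) ≡ true →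
                      ρ (ladder (slotAt r a , inject₁ (proj₁ r))) ≡ false
    owner-not-below r a = implies₂⁻ (clauses⁻ enumRowPoint (All.++⁻ʳ (clauses enumRowPoint ownerBelow) rest₄) (r , a))

    ladder-mono : ∀ s (j : Fin c) (t : Fin (suc c)) → toℕ j < toℕ t → ρ (ladder (s , Fin.suc j)) ≡ true → ρ (ladder (s , t)) ≡ true
    ladder-mono s j = <-weakInduction (λ t → toℕ j < toℕ t → ρ (ladder (s , Fin.suc j)) ≡ true → ρ (ladder (s , t)) ≡ true)
      (λ ()) step
      where
      step : ∀ t → (toℕ j < toℕ (inject₁ t) → ρ (ladder (s , Fin.suc j)) ≡ true → ρ (ladder (s , inject₁ t)) ≡ true) →
             toℕ j < toℕ (Fin.suc t) → ρ (ladder (s , Fin.suc j)) ≡ true → ρ (ladder (s , Fin.suc t)) ≡ true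
      step t ih (s≤s j≤t) p with m≤n⇒m<n∨m≡n j≤t
      ... | inj₁ j<t = ladder-step s t (ih (≤-trans j<t (≤-reflexive (sym (Fin.toℕ-inject₁ t)))) p)
      ... | inj₂ j≡t = subst (λ t → ρ (ladder (s , Fin.suc t)) ≡ true) (Fin.toℕ-injective j≡t) p

    -- If j < j′, the ladder of the common slot is true at j + 1 because of r, hence by monotonicity
    -- at j′, where r′ makes it false.
    same-block : ∀ r r′ a → ρ (rowUsed r) ≡ true → ρ (rowUsed r′) ≡ true → ρ (slotUsed (slotAt r a)) ≡ true →
                 code r a ≡ code r′ a → ¬ (toℕ (proj₁ r) < toℕ (proj₁ r′))
    same-block r r′ a p p′ used eq lt = contradiction
      (trans (sym (ladder-mono (slotAt r a) (proj₁ r) (inject₁ (proj₁ r′)) (≤-trans lt (≤-reflexive (sym (Fin.toℕ-inject₁ _)))) (owner-below r a p used)))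
        (subst (λ v → ρ (ladder ((a , v) , inject₁ (proj₁ r′))) ≡ false) (sym eq)
          (owner-not-below r′ a p′ (subst (λ v → ρ (slotUsed (a , v)) ≡ true) eq used)))) λ ()

    owner-unique : ∀ r r′ a → ρ (rowUsed r) ≡ true → ρ (rowUsed r′) ≡ true → ρ (slotUsed (slotAt r a)) ≡ true →
                   code r a ≡ code r′ a → r ≡ r′
    owner-unique (j , b) (j′ , b′) a p p′ used eq
      with Fin.toℕ-injective (≤-antisym
             (≮⇒≥ (same-block (j′ , b′) (j , b) a p′ p (subst (λ v → ρ (slotUsed (a , v)) ≡ true) eq used) (sym eq)))
             (≮⇒≥ (same-block (j , b) (j′ , b′) a p p′ used eq)))
    -- Once the blocks agree, the constant coefficient is read off from the common value.
    ... | refl = cong (j ,_) (code-injective j a eq)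

    cellOf : ∀ i → ρ (item i) ≡ true → Cell
    cellOf i p = slotAt (row i) (proj₁ (item⇒cell i p)) , col i

    cellOf-injective : ∀ i i′ p p′ → cellOf i p ≡ cellOf i′ p′ → i ≡ i′
    cellOf-injective i i′ p p′ eq with item⇒cell i p | item⇒cell i′ p′
    ... | a , used | a′ , used′ with ,-injectiveˡ eq | ,-injectiveʳ eq
    ...   | slot≡ | col≡ with ,-injectiveˡ slot≡
    ...     | refl = position-injective (owner-unique (row i) (row i′) a (item⇒row i p) (item⇒row i′ p′)
                       (cell⇒slot _ _ used) (,-injectiveʳ slot≡)) col≡

    bound : countTrue (ρ ∘ wire) ≤ k → countTrue (ρ ∘ item) ≤ k
    bound = ≤-trans (countTrue-injection (ρ ∘ item) (ρ ∘ wire) (λ i p → Inverse.from enumCell (cellOf i p))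
      (λ i p → trans (cong (ρ ∘ cellUsed) (Inverse.strictlyInverseˡ enumCell (cellOf i p))) (proj₂ (item⇒cell i p)))
      (λ i i′ p p′ eq → cellOf-injective i i′ p p′ (trans (sym (Inverse.strictlyInverseˡ enumCell (cellOf i p)))
        (trans (cong (Inverse.to enumCell) eq) (Inverse.strictlyInverseˡ enumCell (cellOf i′ p′))))))

  module Complete (τ : Fin n → Bool) (τ≤k : countTrue τ ≤ k) where

    Clashes : Row → Fin n → Fin d → Set
    Clashes r i a = row i ≢ r × code (row i) a ≡ code r a

    clashes? : ∀ r i a → Dec (Clashes r i a)
    clashes? r i a = ¬? (row i ≟Row r) ×-dec (code (row i) a Fin.≟ code r a)

    few-clashes : ∀ r i as → Unique as → All (Clashes r i) as → length as ≤ m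
    -- Empty lists are separate because `row i ≢ r` is only available from an actual clash.
    few-clashes r i []       unique clashes = z≤n
    few-clashes r i (a ∷ as) unique clashes@((r≢ , _) ∷ _) = code-agreement r≢ (a ∷ as) unique (All.map proj₂ clashes)

    -- At most k items are true and each clashes with r in at most m points, while there are d > k m
    -- points. An item lying in r itself never counts as a clash.
    private-point : ∀ r → ∃[ a ] a ∈ allFin d × (∀ i → τ i ≡ true → ¬ Clashes r i a)
    private-point r = avoid τ (clashes? r) (few-clashes r) (allFin d) (Unique.allFin⁺ d)
      (≤-<-trans (*-monoˡ-≤ m τ≤k) (≤-trans km<d (≤-reflexive (sym (length-tabulate {n = d} id)))))

    point : Row → Fin d
    point r = proj₁ (private-point r)

    private-owner : ∀ r i → τ i ≡ true → code (row i) (point r) ≡ code r (point r) → row i ≡ r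
    private-owner r i p eq with row i ≟Row r
    ... | yes row≡ = row≡
    ... | no  row≢ = contradiction (row≢ , eq) (proj₂ (proj₂ (private-point r)) i p)

    slot : Fin n → Slot
    slot i = slotAt (row i) (point (row i))

    RowUsed : Row → Set
    RowUsed r = ∃[ i ] τ i ≡ true × row i ≡ r

    CellUsed : Cell → Set
    CellUsed (s , y) = ∃[ i ] τ i ≡ true × slot i ≡ s × col i ≡ y

    SlotUsed : Slot → Set
    SlotUsed s = ∃[ i ] τ i ≡ true × slot i ≡ s

    OwnedBelow : Slot × Fin (suc c) → Set
    OwnedBelow (s , t) = ∃[ i ] τ i ≡ true × slot i ≡ s × toℕ (proj₁ (row i)) < toℕ t

    rowUsed? : ∀ r → Dec (RowUsed r)
    rowUsed? r = Fin.any? λ i → (τ i Bool.≟ true) ×-dec (row i ≟Row r)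

    cellUsed? : ∀ x → Dec (CellUsed x)
    cellUsed? (s , y) = Fin.any? λ i → (τ i Bool.≟ true) ×-dec (slot i ≟Slot s) ×-dec (col i Fin.≟ y)

    slotUsed? : ∀ s → Dec (SlotUsed s)
    slotUsed? s = Fin.any? λ i → (τ i Bool.≟ true) ×-dec (slot i ≟Slot s)

    ownedBelow? : ∀ x → Dec (OwnedBelow x)
    ownedBelow? (s , t) = Fin.any? λ i → (τ i Bool.≟ true) ×-dec (slot i ≟Slot s) ×-dec (toℕ (proj₁ (row i)) <? toℕ t)

    σ : Aux → Bool
    σ (inj₁ r)               = does (rowUsed? r)
    σ (inj₂ (inj₁ x))        = does (cellUsed? x)
    σ (inj₂ (inj₂ (inj₁ s))) = does (slotUsed? s)
    σ (inj₂ (inj₂ (inj₂ x))) = does (ownedBelow? x)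

    ρ : Var → Bool
    ρ = [ τ , σ ]

    -- The item using the slot does so at the private point of its own row. The true item i′ of row
    -- r passes through the same slot, so privacy puts i′ into that row as well.
    owner : ∀ r a → RowUsed r → (used : SlotUsed (slotAt r a)) → row (proj₁ used) ≡ r
    owner r a (i′ , p′ , refl) (i , p , slot≡) with ,-injectiveˡ slot≡
    ... | refl = sym (private-owner (row i) i′ p′ (sym (,-injectiveʳ slot≡)))

    sat-itemCells : ∀ i → Any (Holds ρ) (itemCells i)
    sat-itemCells i with τ i in eq
    ... | false = here eq
    ... | true  = there (Any.tabulate⁺ (point (row i)) (dec-true (cellUsed? _) (i , eq , refl , refl)))

    sat-ownerBelow : ∀ r a → Any (Holds ρ) (ownerBelow (r , a))
    sat-ownerBelow r a = implies₂⁺ λ p used → below (does⇒ (rowUsed? r) p) (does⇒ (slotUsed? _) used)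
      where
      below : RowUsed r → SlotUsed (slotAt r a) → does (ownedBelow? (slotAt r a , Fin.suc (proj₁ r))) ≡ true
      below ru used@(i , p , slot≡) = dec-true (ownedBelow? _) (i , p , slot≡ , s≤s (≤-reflexive (cong (toℕ ∘ proj₁) (owner r a ru used))))

    sat-ownerNotBelow : ∀ r a → Any (Holds ρ) (ownerNotBelow (r , a))
    sat-ownerNotBelow r a = implies₂⁺ λ p _ → dec-false (ownedBelow? _) (not-below (does⇒ (rowUsed? r) p))
      where
      not-below : RowUsed r → ¬ OwnedBelow (slotAt r a , inject₁ (proj₁ r))
      not-below ru (i , p , slot≡ , lt) = <-irrefl
        (trans (cong (toℕ ∘ proj₁) (owner r a ru (i , p , slot≡))) (sym (Fin.toℕ-inject₁ (proj₁ r)))) lt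

    sat-ladderStep : ∀ x → Any (Holds ρ) (ladderStep x)
    sat-ladderStep (s , j) = implies⁺ λ p → dec-true (ownedBelow? _) (mono (does⇒ (ownedBelow? (s , inject₁ j)) p))
      where
      mono : OwnedBelow (s , inject₁ j) → OwnedBelow (s , Fin.suc j)
      mono (i , p , slot≡ , lt) = i , p , slot≡ , m≤n⇒m≤1+n (≤-trans lt (≤-reflexive (Fin.toℕ-inject₁ j)))

    sat-cellSlot : ∀ x → Any (Holds ρ) (cellSlot x)
    sat-cellSlot (s , y) = implies⁺ λ p → dec-true (slotUsed? s) (forget (does⇒ (cellUsed? (s , y)) p))
      where
      forget : CellUsed (s , y) → SlotUsed s
      forget (i , p , slot≡ , _) = i , p , slot≡

    sat-gadget : Sat ρ gadget
    sat-gadget =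
      All.++⁺ (clauses⁺ (↔-id _) λ i → implies⁺ λ p → dec-true (rowUsed? (row i)) (i , p , refl))
      (All.++⁺ (clauses⁺ (↔-id _) sat-itemCells)
      (All.++⁺ (clauses⁺ enumCell sat-cellSlot)
      (All.++⁺ (clauses⁺ enumCell sat-ladderStep)
      (All.++⁺ (clauses⁺ enumRowPoint (uncurry sat-ownerBelow))
               (clauses⁺ enumRowPoint (uncurry sat-ownerNotBelow))))))

    -- Slot and column are functions of the item, so choosing an item for each used cell is
    -- injective.
    bound : countTrue (ρ ∘ wire) ≤ k
    bound = ≤-trans (countTrue-injection (ρ ∘ wire) τ (λ u p → proj₁ (witness u p)) (λ u p → proj₁ (proj₂ (witness u p))) injective) τ≤k
      where
      witness : ∀ u → ρ (wire u) ≡ true → CellUsed (Inverse.to enumCell u)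
      witness u = does⇒ (cellUsed? (Inverse.to enumCell u))
      same-cell : ∀ {x x′ : Cell} → (w : CellUsed x) (w′ : CellUsed x′) → proj₁ w ≡ proj₁ w′ → x ≡ x′
      same-cell (i , _ , refl , refl) (.i , _ , refl , refl) refl = refl
      injective : ∀ u u′ p p′ → proj₁ (witness u p) ≡ proj₁ (witness u′ p′) → u ≡ u′
      injective u u′ p p′ eq = trans (sym (Inverse.strictlyInverseʳ enumCell u))
        (trans (cong (Inverse.from enumCell) (same-cell (witness u p) (witness u′ p′) eq)) (Inverse.strictlyInverseʳ enumCell u′))

  gridEncoding : Encoding (Fin n) (AtMostK k n) (#aux + 7 * (d * q * c + 2 * k)) (length gadget + 7 * (d * q * c + 2 * k))
  gridEncoding = reduction enumAux gadget wire
    (λ ρ sat → Sound.bound ρ sat)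
    (λ τ τ≤k → Complete.σ τ τ≤k , Complete.sat-gadget τ τ≤k , Complete.bound τ τ≤k)
    (atMostLinear k (d * q * c))

-- Choice of the parameters and the size estimate.

floor-log : ∀ k n → 2 ≤ k → ∃[ l ] k ^ l ≤ suc n × suc n < k ^ suc l
floor-log k zero    2≤k = 0 , ≤-refl , ≤-trans 2≤k (≤-reflexive (sym (*-identityʳ k)))
floor-log k (suc n) 2≤k with floor-log k n 2≤k
... | l , low , high with suc (suc n) <? k ^ suc l
...   | yes high′ = l , m≤n⇒m≤1+n low , high′
...   | no  ¬high = suc l , ≮⇒≥ ¬high , ≤-<-trans high (^-monoʳ-< k 2≤k (n<1+n (suc l)))

ceil-sqrt : ∀ q n → 1 ≤ q → ∃[ c ] c * c * q < suc n × suc n ≤ suc c * suc c * q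
ceil-sqrt q zero    1≤q = 0 , s≤s z≤n , ≤-trans 1≤q (≤-reflexive (sym (+-identityʳ q)))
ceil-sqrt q (suc n) 1≤q with ceil-sqrt q n 1≤q
... | c , low , high with suc (suc n) ≤? suc c * suc c * q
...   | yes high′ = c , m≤n⇒m≤1+n low , high′
...   | no  ¬high = suc c , ≰⇒> ¬high , (begin
  1 + suc n                                       ≤⟨ +-mono-≤ 1≤q high ⟩
  q + suc c * suc c * q                           ≤⟨ m≤m+n _ _ ⟩
  q + suc c * suc c * q + (c + c + 2) * q         ≡⟨ expand c q ⟩
  suc (suc c) * suc (suc c) * q                   ∎)
  where
  open ≤-Reasoning
  expand : ∀ c q → q + suc c * suc c * q + (c + c + 2) * q ≡ suc (suc c) * suc (suc c) * q
  expand = solve-∀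

-- Absorbs q = O(k l) into n ≥ k^l when the grid has a single column.
k*l≤k^l : ∀ k l → 2 ≤ k → 1 ≤ l → k * l ≤ k ^ l
k*l≤k^l k l@(suc l′) 2≤k _ = *-monoʳ-≤ k (suc-l≤ l′)
  where
  open ≤-Reasoning
  suc-l≤ : ∀ l → suc l ≤ k ^ l
  suc-l≤ zero    = ≤-refl
  suc-l≤ (suc l) = begin
    1 + suc l        ≤⟨ +-mono-≤ (s≤s (z≤n {l})) (≤-reflexive (sym (+-identityʳ (suc l)))) ⟩
    2 * suc l        ≤⟨ *-mono-≤ 2≤k (suc-l≤ l) ⟩
    k ^ suc l        ∎

-- The integer l stands in for log_k n. The hypothesis on p / s forces p ≤ l s, and then k^p ≤
-- (k^l)^s ≤ n^s.
square≤⇒BoundedBy : ∀ C n k l {m e} → 2 ≤ k → k ^ l ≤ n → m ≤ e →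
                    e * e ≤ C * C * n * k ^ 3 * l ^ 3 → BoundedBy C n k m
square≤⇒BoundedBy C n k l {m} {e} 2≤k k^l≤n m≤e e²≤ p s 1≤s hyp = begin
  k ^ p        ≤⟨ ^-monoʳ-≤ k {{>-nonZero (≤-trans (s≤s z≤n) 2≤k)}} p≤ls ⟩
  k ^ (l * s)  ≡⟨ ^-*-assoc k l s ⟨
  (k ^ l) ^ s  ≤⟨ ^-monoˡ-≤ s k^l≤n ⟩
  n ^ s        ∎
  where
  open ≤-Reasoning
  regroup : ∀ C n K l s → C * C * n * K * (l * (l * (l * 1))) * (s * (s * (s * 1))) ≡ l * s * (l * s * (l * s * 1)) * (C * C) * n * K
  regroup = solve-∀
  p≤ls : p ≤ l * s
  p≤ls = ≮⇒≥ λ ls<p → <⇒≱ hyp (begin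
    m * m * s ^ 3                          ≤⟨ *-monoˡ-≤ (s ^ 3) (≤-trans (*-mono-≤ m≤e m≤e) e²≤) ⟩
    C * C * n * k ^ 3 * l ^ 3 * s ^ 3      ≡⟨ regroup C n (k ^ 3) l s ⟩
    (l * s) ^ 3 * (C * C) * n * k ^ 3      ≤⟨ *-monoˡ-≤ (k ^ 3) (*-monoˡ-≤ n (*-monoˡ-≤ (C * C) (^-monoˡ-≤ 3 (<⇒≤ ls<p)))) ⟩
    p ^ 3 * (C * C) * n * k ^ 3            ∎)

SmallEncoding : (C n k : ℕ) → Set
SmallEncoding C n k = ∃[ a ] ∃[ φ ] (Encodes n a (AtMostK k n) φ
             × (∃[ e ] (length φ ≤ 2 * n + e × BoundedBy C n k e))
             × BoundedBy C n k a)

smallEncoding : ∀ {C n k a c e} → Encoding (Fin n) (AtMostK k n) a c → a ≤ e → c ≤ 2 * n + e →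
                (∀ {m} → m ≤ e → BoundedBy C n k m) → SmallEncoding C n k
smallEncoding {e = e} E a≤e c≤2n+e bounded with encodes E
... | a , φ , enc , a≤ , len≤ = a , φ , enc , (e , ≤-trans len≤ c≤2n+e , bounded ≤-refl) , bounded (≤-trans a≤ a≤e)

module Parameters
  {n k l c′ q B : ℕ} (2≤k : 2 ≤ k) (1≤l : 1 ≤ l) (k^l≤n : k ^ l ≤ n) (n<k^[1+l] : n < k ^ suc l)
  (q-prime : Prime q) (d≤q : k * suc (suc l) ≤ q) (1≤B : 1 ≤ B) (q≤Bd : q ≤ B * (k * suc (suc l)))
  (c′²q<n : c′ * c′ * q < n) (n≤c²q : n ≤ suc c′ * suc c′ * q)
  where

  open ≤-Reasoning

  m d c T : ℕ
  m = suc l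
  -- Equal to k m + k, thus beyond the k m possible clashes.
  d = k * suc m
  c = suc c′
  T = d * q * c

  instance
    k≢0 : NonZero k
    k≢0 = >-nonZero (≤-trans (s≤s z≤n) 2≤k)
    q≢0 : NonZero q
    q≢0 = prime⇒nonZero q-prime
    d≢0 : NonZero d
    d≢0 = m*n≢0 k (suc m)

  -- Ensures that the l + 1 digits after the constant coefficient can spell every j.
  c≤q^m : c ≤ q ^ m
  c≤q^m = begin
    suc c′    ≤⟨ c≤n c′ c′²q<n ⟩
    n         ≤⟨ <⇒≤ n<k^[1+l] ⟩
    k ^ m     ≤⟨ ^-monoˡ-≤ m (≤-trans (m≤m*n k (suc m)) d≤q) ⟩
    q ^ m     ∎
    where
    c≤n : ∀ c′ → c′ * c′ * q < n → suc c′ ≤ n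
    c≤n zero     lt = lt
    c≤n c@(suc _) lt = ≤-trans (s≤s (≤-trans (m≤m*n c c) (m≤m*n (c * c) q))) lt

  open ReedSolomon q-prime
  open Digits {c} {q} m c≤q^m

  word : Fin c × Fin q → Vec (Fin q) (suc m)
  word (j , b) = b ∷ digits j

  word-injective : ∀ {r r′} → word r ≡ word r′ → r ≡ r′
  word-injective eq with ∷-injective eq
  ... | refl , digits≡ = cong (_, _) (digits-injective digits≡)

  code : Fin c × Fin q → Fin d → Fin q
  code r a = value (word r) (toℕ a)

  code-injective : ∀ j {b b′} a → code (j , b) a ≡ code (j , b′) a → b ≡ b′
  code-injective j {b} {b′} a = value-head-injective b b′ (digits j) (toℕ a)

  code-agreement : ∀ {r r′} → r ≢ r′ → ∀ as → Unique as → All (λ a → code r a ≡ code r′ a) as → length as ≤ m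
  code-agreement {r} {r′} r≢r′ = agreement-bound {w = word r} {word r′} (λ eq → r≢r′ (word-injective eq)) d≤q

  n≤cqc : n ≤ c * q * c
  n≤cqc = ≤-trans n≤c²q (≤-reflexive (swap c q))
    where
    swap : ∀ c q → c * c * q ≡ c * q * c
    swap = solve-∀

  open GridEncoding {n} {k} n≤cqc (*-monoʳ-< k ≤-refl) code code-injective code-agreement
    using (gridEncoding; gadget; length-gadget; #aux)

  k≤T : k ≤ T
  k≤T = ≤-trans (m≤m*n k (suc m)) (≤-trans (m≤m*n d q) (m≤m*n (d * q) c))

  aux≤ : #aux + 7 * (T + 2 * k) ≤ 26 * T
  aux≤ = begin
    c * q + (T + (d * q + d * q * suc c)) + 7 * (T + 2 * k)
      ≤⟨ +-mono-≤ (+-mono-≤ (≤-trans (≤-reflexive (*-comm c q)) (*-monoˡ-≤ c (m≤n*m q d)))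
           (+-monoʳ-≤ T (+-mono-≤ dq≤T (≤-trans (≤-reflexive (*-suc (d * q) c)) (+-monoˡ-≤ T dq≤T)))))
           (*-monoʳ-≤ 7 (+-monoʳ-≤ T (*-monoʳ-≤ 2 k≤T))) ⟩
    -- One T each for rows, cells and slots, two for the ladders, and 7 · 3 T for the counter.
    T + (T + (T + (T + T))) + 7 * (T + 2 * T)
      ≡⟨ collect T ⟩
    26 * T ∎
    where
    dq≤T : d * q ≤ T
    dq≤T = m≤m*n (d * q) c
    collect : ∀ T → T + (T + (T + (T + T))) + 7 * (T + 2 * T) ≡ 26 * T
    collect = solve-∀

  clauses≤ : length gadget + 7 * (T + 2 * k) ≤ 2 * n + 26 * T
  clauses≤ = begin
    length gadget + 7 * (T + 2 * k)
      ≤⟨ +-mono-≤ (≤-reflexive (trans length-gadget (regroup n d q c))) (*-monoʳ-≤ 7 (+-monoʳ-≤ T (*-monoʳ-≤ 2 k≤T))) ⟩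
    2 * n + 4 * T + 7 * (T + 2 * T)
      ≤⟨ m≤m+n _ T ⟩
    2 * n + 4 * T + 7 * (T + 2 * T) + T
      ≡⟨ collect n T ⟩
    2 * n + 26 * T ∎
    where
    regroup : ∀ n d q c → n + (n + (d * q * c + (d * q * c + (c * q * d + c * q * d)))) ≡ 2 * n + 4 * (d * q * c)
    regroup = solve-∀
    collect : ∀ n T → 2 * n + 4 * T + 7 * (T + 2 * T) + T ≡ 2 * n + 26 * T
    collect = solve-∀

  d≤3kl : d ≤ 3 * (k * l)
  d≤3kl = begin
    k * (2 + l)        ≤⟨ *-monoʳ-≤ k (+-monoˡ-≤ l (*-monoʳ-≤ 2 1≤l)) ⟩
    k * (2 * l + l)    ≡⟨ regroup k l ⟩
    3 * (k * l)        ∎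
    where
    regroup : ∀ k l → k * (2 * l + l) ≡ 3 * (k * l)
    regroup = solve-∀

  q≤3Bkl : q ≤ 3 * B * (k * l)
  q≤3Bkl = begin
    q                    ≤⟨ q≤Bd ⟩
    B * d                ≤⟨ *-monoʳ-≤ B d≤3kl ⟩
    B * (3 * (k * l))    ≡⟨ regroup B (k * l) ⟩
    3 * B * (k * l)      ∎
    where
    regroup : ∀ B x → B * (3 * x) ≡ 3 * B * x
    regroup = solve-∀

  -- For c′ ≥ 1, the step from c′ to c′ + 1 at most quadruples c′² q < n; for c′ = 0, the product is
  -- q itself. A factor 4 B would suffice; 12 B makes 27 · 12 = 18² a perfect square in the final
  -- constant.
  c²q≤12Bn : c * c * q ≤ 12 * B * n
  c²q≤12Bn = go c′ c′²q<n
    where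
    go : ∀ c′ → c′ * c′ * q < n → suc c′ * suc c′ * q ≤ 12 * B * n
    go zero _ = begin
      1 * 1 * q            ≡⟨ *-identityˡ q ⟩
      q                    ≤⟨ q≤3Bkl ⟩
      3 * B * (k * l)      ≤⟨ *-mono-≤ (*-monoˡ-≤ B (m≤m+n 3 9)) (≤-trans (k*l≤k^l k l 2≤k 1≤l) k^l≤n) ⟩
      12 * B * n           ∎
    go c@(suc c′) lt = begin
      suc c * suc c * q            ≤⟨ *-monoˡ-≤ q (*-mono-≤ double double) ⟩
      (2 * c) * (2 * c) * q        ≡⟨ regroup c q ⟩
      4 * (c * c * q)              ≤⟨ *-mono-≤ (≤-trans (m≤m+n 4 8) (m≤m*n 12 B {{>-nonZero 1≤B}})) (<⇒≤ lt) ⟩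
      12 * B * n                   ∎
      where
      double : suc c ≤ 2 * c
      double = ≤-trans (s≤s (m≤n+m c c′)) (≤-reflexive (cong (c +_) (sym (+-identityʳ c))))
      regroup : ∀ c q → (2 * c) * (2 * c) * q ≡ 4 * (c * c * q)
      regroup = solve-∀

  -- 26² · 3 · 3 · 3 · 12 = 468².
  square-bound : (26 * T) * (26 * T) ≤ (468 * B) * (468 * B) * n * k ^ 3 * l ^ 3
  square-bound = begin
    (26 * T) * (26 * T)                          ≡⟨ separate d q c ⟩
    676 * (d * d * q * (c * c * q))              ≤⟨ *-monoʳ-≤ 676 (*-mono-≤ (*-mono-≤ (*-mono-≤ d≤3kl d≤3kl) q≤3Bkl) c²q≤12Bn) ⟩
    676 * (3 * (k * l) * (3 * (k * l)) * (3 * B * (k * l)) * (12 * B * n))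
                                                 ≡⟨ collect n k l B ⟩
    (468 * B) * (468 * B) * n * k ^ 3 * l ^ 3    ∎
    where
    separate : ∀ d q c → (26 * (d * q * c)) * (26 * (d * q * c)) ≡ 676 * (d * d * q * (c * c * q))
    separate = solve-∀
    collect : ∀ n k l B → 676 * (3 * (k * l) * (3 * (k * l)) * (3 * B * (k * l)) * (12 * B * n)) ≡
                          (468 * B) * (468 * B) * n * (k * (k * (k * 1))) * (l * (l * (l * 1)))
    collect = solve-∀

  result : SmallEncoding (468 * B) n k
  result = smallEncoding {468 * B} {e = 26 * T} gridEncoding aux≤ clauses≤
    λ {m} m≤26T → square≤⇒BoundedBy (468 * B) n k l {m} {26 * T} 2≤k k^l≤n m≤26T square-bound

-- The case n ≤ k and the final constant.

trivial-encoding : ∀ {n k} C → n ≤ k → SmallEncoding C n k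
trivial-encoding C n≤k = 0 , [] , (λ τ → mk⇔ (λ _ → (λ ()) , []) (λ _ → ≤-trans (countTrue≤n τ) n≤k)) ,
  -- `BoundedBy` is vacuous at 0, since nothing lies below 0 · 0 · s³.
  (0 , z≤n , λ p s _ ()) , λ p s _ ()

small-encoding : ∀ B → 1 ≤ B → (∀ x → 1 ≤ x → ∃[ p ] Prime p × x ≤ p × p ≤ B * x) →
                 ∀ n k → 2 ≤ k → SmallEncoding (468 * B) (suc n) k
small-encoding B 1≤B primes n k 2≤k = by-size (suc n ≤? k)
  where
  by-root : ∀ {l q} → 1 ≤ l → k ^ l ≤ suc n → suc n < k ^ suc l →
            Prime q → k * suc (suc l) ≤ q → q ≤ B * (k * suc (suc l)) →
            ∃[ c ] c * c * q < suc n × suc n ≤ suc c * suc c * q → SmallEncoding (468 * B) (suc n) k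
  by-root 1≤l k^l≤n n<k^[1+l] q-prime d≤q q≤Bd (c , low , high) =
    Parameters.result {c′ = c} {B = B} 2≤k 1≤l k^l≤n n<k^[1+l] q-prime d≤q 1≤B q≤Bd low high
  by-prime : ∀ l → 1 ≤ l → k ^ l ≤ suc n → suc n < k ^ suc l →
             ∃[ q ] Prime q × k * suc (suc l) ≤ q × q ≤ B * (k * suc (suc l)) → SmallEncoding (468 * B) (suc n) k
  by-prime l 1≤l k^l≤n n<k^[1+l] (q , q-prime , d≤q , q≤Bd) =
    by-root 1≤l k^l≤n n<k^[1+l] q-prime d≤q q≤Bd (ceil-sqrt q n (>-nonZero⁻¹ q {{prime⇒nonZero q-prime}}))
  by-log : ¬ suc n ≤ k → ∃[ l ] k ^ l ≤ suc n × suc n < k ^ suc l → SmallEncoding (468 * B) (suc n) k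
  -- Here l = 0 would mean n < k. So l ≥ 1, which is what bounds l + 2 by 3 l.
  by-log n≰k (zero , _ , n<k) = contradiction (≤-trans (<⇒≤ n<k) (≤-reflexive (*-identityʳ k))) n≰k
  by-log n≰k (l@(suc _) , k^l≤n , n<k^[1+l]) = by-prime l (s≤s z≤n) k^l≤n n<k^[1+l]
    (primes (k * suc (suc l)) (*-mono-≤ (≤-trans (s≤s z≤n) 2≤k) (s≤s (z≤n {suc l}))))
  by-size : Dec (suc n ≤ k) → SmallEncoding (468 * B) (suc n) k
  by-size (yes n≤k) = trivial-encoding (468 * B) n≤k
  by-size (no  n≰k) = by-log n≰k (floor-log k n 2≤k)

theorem4 : ∃[ C ] ((n k : ℕ) → 1 ≤ n → 2 ≤ k →
    ∃[ a ] ∃[ φ ] (Encodes n a (AtMostK k n) φ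
    × (∃[ e ] (length φ ≤ 2 * n + e × BoundedBy C n k e))
    × BoundedBy C n k a))
theorem4 = from-primes bertrand
  where
  from-primes : ∃[ B ] 1 ≤ B × (∀ x → 1 ≤ x → ∃[ p ] Prime p × x ≤ p × p ≤ B * x) →
                ∃[ C ] ((n k : ℕ) → 1 ≤ n → 2 ≤ k → SmallEncoding C n k)
  from-primes (B , 1≤B , primes) = 468 * B , λ where
    (suc n) k _ 2≤k → small-encoding B 1≤B primes n k 2≤k
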